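{- Let $\Sigma$ be a finite alphabet and $e,f\in\mathrm{RegE}(\Sigma)$. If Duplicator has a winning strategy in the simulation game from the position $(\emptyset\mid\{e\}\vdash f)$, then $e\le f$ is derivable in $\mathsf{SRKAM}$.
   Context: $\mathrm{RegE}(\Sigma)$ is the set of expressions generated by $e::=a\ (a\in\Sigma)\mid0\mid\top\mid1\mid e\sqcup e\mid e\sqcap e\mid e\star e\mid e^\diamond$. $\mathsf{SRKAM}$: $e\le f$ is derivable if obtained from reflexivity $a\le a$ and the following axiom schemes / Horn rules, for arbitrary expressions $a,b,c,a',b'$ ($a=b$ abbreviates both inequalities): $a\le b\wedge b\le c\Rightarrow a\le c$; $0\le a$; $a\le\top$; $a\le a\sqcup b$; $b\le a\sqcup b$; $b\le a\wedge c\le a\Rightarrow b\sqcup c\le a$; $a\sqcap b\le a$; $a\sqcap b\le b$; $a\le b\wedge a\le c\Rightarrow a\le b\sqcap c$; $a\sqcap(b\sqcup c)\le(a\sqcap b)\sqcup(a\sqcap c)$; $a\star1=a=1\star a$; $a\star(b\star c)=(a\star b)\star c$; $a\le a'\wedge b\le b'\Rightarrow a\star b\le a'\star b'$; $a\star0\le0$; $\top\le a\star\top$; $a\star(b\sqcup c)\le(a\star b)\sqcup(a\star c)$; $(a\star b)\sqcap(a\star c)\le a\star(b\sqcap c)$; $(a\star b)\sqcap c\le(a\sqcap c)\star b$; $1\le a^\diamond$; $a^\diamond\star a\le a^\diamond$; $a\sqcap(b\star c)\le b\Rightarrow a\sqcap(b\star c^\diamond)\le b$. Simulation game. Transitions $\to$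 on expressions: least relation with $e\sqcup f\to e$, $e\sqcup f\to f$, $e\sqcap f\to e$, $e\sqcap f\to f$, $a\to1$ ($a\in\Sigma$), $e\star1\to e$, $e^\diamond\to1$, $e^\diamond\to e^\diamond\star e$, and $g\star e\to g\star f$ whenever $e\to f$. Polarity: $\mathrm{pol}(e\star f)=\mathrm{pol}(f)$; $\exists$ for $e\sqcup f$, $1$, $0$, $e^\diamond$; $\forall$ for $e\sqcap f$, $\top$; $?a$ for a letter $a$. Positions $(\Gamma\mid X\vdash e)$ with $\Gamma\subseteq\Sigma$, $X$ a finite set of expressions, $e$ an expression. Position polarity: $\forall$ if some $t\in X\setminus\{1\}$ has polarity in $\{\exists,\forall\}$; else $\mathrm{pol}(e)$ if in $\{\exists,\forall\}$; else $\exists$. Moves ($X\uplus\{t\}$ means $t\notin X$): EXPLORE $(\Gamma\mid X\uplus\{t\}\vdash e)\to(\Gamma\mid X\cup\{t'\}\vdash e)$ if $\mathrm{pol}(t)=\exists$, $t\to t'$; FORK $(\Gamma\mid X\uplus\{t\}\vdash e)\to(\Gamma\mid X\cup\{t':t\to t'\}\vdash e)$ if $\mathrm{pol}(t)=\forall$; ALEA $(\Gamma\mid X\vdash e)\to(\Gamma\mid X\vdash e')$ if $\mathrm{pol}(e)=\forall$, all elements of $X$ of polarity $\exists$ or $\forall$ equal $1$, $e\to e'$; CHOOSE $(\Gamma\mid X\vdash e)\to(\Gamma\mid X\vdash e')$ if position and $e$ have polarity $\exists$, $e\to e'$; JUNK $(\Gamma\mid X\vdash e)\to(\Gamma\mid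 X\vdash e')$ if position polarity $\exists$, $\mathrm{pol}(e)=?a$, $a\in\Gamma$, $e\to e'$; FILL $(\Gamma\mid X\uplus\{t\}\vdash e)\to(\Gamma\cup\{a\}\mid X\cup\{t'\}\vdash e')$ if position polarity $\exists$, $\mathrm{pol}(e)=\mathrm{pol}(t)=?a$, $e\to e'$, $t\to t'$. Duplicator moves at $\exists$-positions, Spoiler at $\forall$-positions. Winning positions: polarity $\forall$ with no ALEA move available. Duplicator wins a maximal finite play iff its last position is winning, and an infinite play iff it visits winning positions infinitely often. -}

module Defs where

open import Data.Nat using (ℕ; zero; suc) renaming (_≤_ to _≤ℕ_)
open import Data.Fin using (Fin)
open import Data.Fin.Subset using (Subset; ⁅_⁆) renaming (_∈_ to _∈ˢ_; _∪_ to _∪ˢ_; ⊥ to ∅)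
open import Data.List using (List; []; _∷_)
open import Data.List.Membership.Propositional using (_∈_)
open import Data.Product using (Σ; _×_; _,_)
open import Data.Sum using (_⊎_)
open import Relation.Binary.PropositionalEquality using (_≡_; _≢_)
open import Relation.Nullary using (¬_)

infixl 6 _⊔_
infixl 7 _⊓_
infixl 8 _⋆_
infix  9 _◇

data Expr (n : ℕ) : Set where
  lit  : Fin n → Expr n
  𝟘    : Expr n
  ⊤ᵉ   : Expr n
  𝟙    : Expr n
  _⊔_  : Expr n → Expr n → Expr n
  _⊓_  : Expr n → Expr n → Expr n
  _⋆_  : Expr n → Expr n → Expr n
  _◇   : Expr n → Expr n

infix 4 _≤_

data _≤_ {n : ℕ} : Expr n → Expr n → Set where
  refl      : ∀ {a} → a ≤ a
  trans     : ∀ {a b c} → a ≤ b → b ≤ c → a ≤ c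
  0≤        : ∀ {a} → 𝟘 ≤ a
  ≤⊤        : ∀ {a} → a ≤ ⊤ᵉ
  ⊔-inl     : ∀ {a b} → a ≤ a ⊔ b
  ⊔-inr     : ∀ {a b} → b ≤ a ⊔ b
  ⊔-lub     : ∀ {a b c} → b ≤ a → c ≤ a → b ⊔ c ≤ a
  ⊓-l       : ∀ {a b} → a ⊓ b ≤ a
  ⊓-r       : ∀ {a b} → a ⊓ b ≤ b
  ⊓-glb     : ∀ {a b c} → a ≤ b → a ≤ c → a ≤ b ⊓ c
  distr     : ∀ {a b c} → a ⊓ (b ⊔ c) ≤ (a ⊓ b) ⊔ (a ⊓ c)
  unitʳ-≤   : ∀ {a} → a ⋆ 𝟙 ≤ a
  unitʳ-≥   : ∀ {a} → a ≤ a ⋆ 𝟙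
  unitˡ-≤   : ∀ {a} → 𝟙 ⋆ a ≤ a
  unitˡ-≥   : ∀ {a} → a ≤ 𝟙 ⋆ a
  assoc-≤   : ∀ {a b c} → a ⋆ (b ⋆ c) ≤ (a ⋆ b) ⋆ c
  assoc-≥   : ∀ {a b c} → (a ⋆ b) ⋆ c ≤ a ⋆ (b ⋆ c)
  ⋆-mono    : ∀ {a b a′ b′} → a ≤ a′ → b ≤ b′ → a ⋆ b ≤ a′ ⋆ b′
  ⋆-zero    : ∀ {a} → a ⋆ 𝟘 ≤ 𝟘
  ⋆-top     : ∀ {a} → ⊤ᵉ ≤ a ⋆ ⊤ᵉ
  ⋆-distr-⊔ : ∀ {a b c} → a ⋆ (b ⊔ c) ≤ (a ⋆ b) ⊔ (a ⋆ c)
  ⋆-distr-⊓ : ∀ {a b c} → (a ⋆ b) ⊓ (a ⋆ c) ≤ a ⋆ (b ⊓ c)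
  ⋆-⊓-left  : ∀ {a b c} → (a ⋆ b) ⊓ c ≤ (a ⊓ c) ⋆ b
  ◇-unit    : ∀ {a} → 𝟙 ≤ a ◇
  ◇-unfold  : ∀ {a} → a ◇ ⋆ a ≤ a ◇
  ◇-ind     : ∀ {a b c} → a ⊓ (b ⋆ c) ≤ b → a ⊓ (b ⋆ c ◇) ≤ b

infix 4 _⟶_

data _⟶_ {n : ℕ} : Expr n → Expr n → Set where
  ⊔-l  : ∀ {e f} → e ⊔ f ⟶ e
  ⊔-r  : ∀ {e f} → e ⊔ f ⟶ f
  ⊓-l  : ∀ {e f} → e ⊓ f ⟶ e
  ⊓-r  : ∀ {e f} → e ⊓ f ⟶ f
  lit  : ∀ {a} → lit a ⟶ 𝟙
  ⋆-𝟙  : ∀ {e} → e ⋆ 𝟙 ⟶ e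
  ◇-𝟙  : ∀ {e} → e ◇ ⟶ 𝟙
  ◇-un : ∀ {e} → e ◇ ⟶ e ◇ ⋆ e
  ⋆-ctx : ∀ {g e f} → e ⟶ f → g ⋆ e ⟶ g ⋆ f

data Pol (n : ℕ) : Set where
  ∃ₚ : Pol n
  ∀ₚ : Pol n
  ?ₚ : Fin n → Pol n

pol : ∀ {n} → Expr n → Pol n
pol (lit a) = ?ₚ a
pol 𝟘       = ∃ₚ
pol ⊤ᵉ      = ∀ₚ
pol 𝟙       = ∃ₚ
pol (e ⊔ f) = ∃ₚ
pol (e ⊓ f) = ∀ₚ
pol (e ⋆ f) = pol f
pol (e ◇)   = ∃ₚ

Quant : ∀ {n} → Pol n → Set
Quant p = p ≡ ∃ₚ ⊎ p ≡ ∀ₚ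

-- Positions (Γ | X ⊢ e); the finite set X is represented by a list,
-- read extensionally (only membership matters).

record Pos (n : ℕ) : Set where
  constructor ⟨_∣_⊢_⟩
  field
    Γ : Subset n
    X : List (Expr n)
    goal : Expr n

open Pos public

Blocking : ∀ {n} → List (Expr n) → Set
Blocking X = Σ _ λ t → t ∈ X × t ≢ 𝟙 × Quant (pol t)

ForallPos : ∀ {n} → Pos n → Set
ForallPos p = Blocking (X p) ⊎ pol (goal p) ≡ ∀ₚ

ExistsPos : ∀ {n} → Pos n → Set
ExistsPos p = ¬ ForallPos p

Represents : ∀ {n} → List (Expr n) → (Expr n → Set) → Set
Represents Y P = ∀ y → (y ∈ Y → P y) × (P y → y ∈ Y)

Replace : ∀ {n} → List (Expr n) → Expr n → Expr n → List (Expr n) → Set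
Replace X t t′ Y = Represents Y (λ y → (y ∈ X × y ≢ t) ⊎ y ≡ t′)

ForkSet : ∀ {n} → List (Expr n) → Expr n → List (Expr n) → Set
ForkSet X t Y = Represents Y (λ y → (y ∈ X × y ≢ t) ⊎ t ⟶ y)

data Alea {n : ℕ} : Pos n → Pos n → Set where
  alea : ∀ {Γ X e e′} → pol e ≡ ∀ₚ →
         (∀ t → t ∈ X → Quant (pol t) → t ≡ 𝟙) →
         e ⟶ e′ → Alea ⟨ Γ ∣ X ⊢ e ⟩ ⟨ Γ ∣ X ⊢ e′ ⟩

data Move {n : ℕ} : Pos n → Pos n → Set where
  explore : ∀ {Γ X Y e t t′} → t ∈ X → pol t ≡ ∃ₚ → t ⟶ t′ →
            Replace X t t′ Y → Move ⟨ Γ ∣ X ⊢ e ⟩ ⟨ Γ ∣ Y ⊢ e ⟩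
  fork    : ∀ {Γ X Y e t} → t ∈ X → pol t ≡ ∀ₚ →
            ForkSet X t Y → Move ⟨ Γ ∣ X ⊢ e ⟩ ⟨ Γ ∣ Y ⊢ e ⟩
  alea    : ∀ {p q} → Alea p q → Move p q
  choose  : ∀ {Γ X e e′} → ExistsPos ⟨ Γ ∣ X ⊢ e ⟩ → pol e ≡ ∃ₚ →
            e ⟶ e′ → Move ⟨ Γ ∣ X ⊢ e ⟩ ⟨ Γ ∣ X ⊢ e′ ⟩
  junk    : ∀ {Γ X e e′ a} → ExistsPos ⟨ Γ ∣ X ⊢ e ⟩ → pol e ≡ ?ₚ a →
            a ∈ˢ Γ → e ⟶ e′ → Move ⟨ Γ ∣ X ⊢ e ⟩ ⟨ Γ ∣ X ⊢ e′ ⟩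
  fill    : ∀ {Γ X Y e e′ t t′ a} → ExistsPos ⟨ Γ ∣ X ⊢ e ⟩ →
            pol e ≡ ?ₚ a → t ∈ X → pol t ≡ ?ₚ a → e ⟶ e′ → t ⟶ t′ →
            Replace X t t′ Y →
            Move ⟨ Γ ∣ X ⊢ e ⟩ ⟨ Γ ∪ˢ ⁅ a ⁆ ∣ Y ⊢ e′ ⟩

Winning : ∀ {n} → Pos n → Set
Winning p = ForallPos p × (∀ q → ¬ Alea p q)

-- Strategies.  A (possibly nondeterministic) strategy for Duplicator is
-- a set S of histories (lists of positions, most recent first).

History : ℕ → Set
History n = List (Pos n)

prefix : ∀ {n} → (ℕ → Pos n) → ℕ → History n
prefix π zero    = π zero ∷ []
prefix π (suc i) = π (suc i) ∷ prefix π i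

record WinningStrategy {n : ℕ} (p₀ : Pos n) : Set₁ where
  field
    S        : History n → Set
    start    : S (p₀ ∷ [])
    spoiler  : ∀ {h p q} → S (p ∷ h) → ForallPos p → Move p q → S (q ∷ p ∷ h)
    duplicator : ∀ {h p} → S (p ∷ h) → ExistsPos p →
                 Σ (Pos n) λ q → Move p q × S (q ∷ p ∷ h)
    finite-win : ∀ {h p} → S (p ∷ h) → (∀ q → ¬ Move p q) → Winning p
    infinite-win : (π : ℕ → Pos n) → π zero ≡ p₀ →
                   (∀ i → Move (π i) (π (suc i))) → (∀ i → S (prefix π i)) →
                   ∀ k → Σ ℕ λ m → k ≤ℕ m × Winning (π m)

DuplicatorWins : ∀ {n} → Pos n → Set₁
DuplicatorWins p₀ = WinningStrategy p₀

{-# OPTIONS --safe #-}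
module Submission where

open import Defs
open import Data.Bool using (true; false; if_then_else_)
open import Data.Empty using (⊥)
open import Data.Fin using (Fin)
import Data.Fin.Properties as Finₚ
open import Data.Fin.Subset using (Subset; ⁅_⁆; inside; outside) renaming (_∈_ to _∈ˢ_; _∪_ to _∪ˢ_; ⊥ to ∅)
open import Data.Fin.Subset.Properties using (x∈p∪q⁻; x∈⁅y⁆⇒x≡y; ∉⊥) renaming (_∈?_ to _∈ˢ?_)
open import Data.List using (List; []; _∷_; _++_; map; filter; length; concatMap; allFin;
                             cartesianProductWith; cartesianProduct)
import Data.List.Membership.DecPropositional as DecMembership
open import Data.List.Membership.Propositional using (_∈_; _∉_; lose; find)
open import Data.List.Membership.Propositional.Properties
open import Data.List.Properties using (filter-≐; ≡-dec; map-++)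
open import Data.List.Relation.Binary.Subset.Propositional using (_⊆_)
open import Data.List.Relation.Unary.All as All using (All; []; _∷_; all?)
open import Data.List.Relation.Unary.All.Properties using (¬All⇒Any¬)
open import Data.List.Relation.Unary.Any as Any using (Any; here; there; any?; _─_)
open import Data.Nat using (ℕ; zero; suc; _+_; _*_; z≤n; s≤s; >-nonZero) renaming (_≤_ to _≤ℕ_; _<_ to _<ℕ_)
open import Data.Nat.Induction using (<-wellFounded)
open import Data.Nat.ListAction using (sum)
open import Data.Nat.ListAction.Properties using (sum-++)
import Data.Nat.Properties as ℕₚ
open import Data.Product as Product using (Σ; ∃; _×_; _,_; proj₁; proj₂)
open import Data.Sum as Sum using (_⊎_; inj₁; inj₂; [_,_]′)
open import Data.Unit using (⊤; tt)
open import Data.Vec using ([]; _∷_)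
open import Function using (_∘_; id)
open import Induction.WellFounded using (Acc; acc)
open import Relation.Binary.PropositionalEquality as ≡ using (_≡_; _≢_; refl; sym; cong; subst)
open import Relation.Nullary using (¬_; Dec; yes; no; contradiction)
open import Relation.Nullary.Decidable using (map′; _×-dec_; _⊎-dec_; _→-dec_; ¬?; does; decidable-stable)
open import Relation.Unary using (Decidable)

-- Up to equality of sets X the arena is finite, so the region W that Duplicator wins can be
-- computed as a fixpoint νZ.μR.Step Z R, and it contains the starting position.
--
-- Let D be a finite set of expressions, read as their meet. We show that D lies below the goal
-- of every winning position with X ⊆ D, by induction on the part of the closure missing from
-- D. Let ω be the meet of those goals. By induction, D ⊓ s ≤ ω as soon as s is new, so Spoiler
-- may be assumed to explore inside D. A value w ⋆ c ◇ is unfolded by ◇-ind with the invariant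
-- b = (w ⋆ c ◇) ⊓ ω: when b ⋆ c has been explored back to b, nothing is left to prove, because
-- b ≤ ω. Hence no exploration ever unfolds a ◇ again, and the whole process terminates.

-- FILL shapes the bookkeeping. If `v ≤ h ⋆ lit a` is the value being filled, `⋆-⊓-left` gives
-- `v ≤ (h ⊓ v) ⋆ lit a`: the letter is split off, every bound known for `v` survives, and `h ⊓ v`
-- has to be put below the new goal. The value has changed and exploration resumes at `h`, so the
-- argument cannot be tied to one `v` and one goal. The meet `ω` serves all goals at once and can be
-- written into a loop invariant before the course of the game is known. When the same item is
-- filled again, `v ≤ h` is already known and the move is justified like JUNK, so each letter has to
-- be awaited only once. The two fixpoints reflect the winning condition. A winning position is
-- either blocking or has a goal of polarity ∀ without successors, where the play ends. Hence an
-- infinite play is won iff Spoiler moves on the left infinitely often, and between two such moves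
-- Duplicator has a finite rank to spend on the right.

private variable
  n : ℕ

-- Expressions and transitions

infix 4 _≟_

-- Comparing constructor tags first leaves only the diagonal cases.
_≟_ : (e f : Expr n) → Dec (e ≡ f)
e ≟ f with tag e ℕₚ.≟ tag f
  where
  tag : Expr n → ℕ
  tag (lit _) = 0
  tag 𝟘 = 1
  tag ⊤ᵉ = 2
  tag 𝟙 = 3
  tag (_ ⊔ _) = 4
  tag (_ ⊓ _) = 5
  tag (_ ⋆ _) = 6
  tag (_ ◇) = 7
... | no t≢ = no λ { refl → t≢ refl }
lit a ≟ lit b | yes _ = map′ (cong lit) (λ { refl → refl }) (a Finₚ.≟ b)
𝟘 ≟ 𝟘 | yes _ = yes refl
⊤ᵉ ≟ ⊤ᵉ | yes _ = yes refl
𝟙 ≟ 𝟙 | yes _ = yes refl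
(a ⊔ b) ≟ (c ⊔ d) | yes _ = map′ (λ { (refl , refl) → refl }) (λ { refl → refl , refl }) (a ≟ c ×-dec b ≟ d)
(a ⊓ b) ≟ (c ⊓ d) | yes _ = map′ (λ { (refl , refl) → refl }) (λ { refl → refl , refl }) (a ≟ c ×-dec b ≟ d)
(a ⋆ b) ≟ (c ⋆ d) | yes _ = map′ (λ { (refl , refl) → refl }) (λ { refl → refl , refl }) (a ≟ c ×-dec b ≟ d)
(a ◇) ≟ (b ◇) | yes _ = map′ (cong _◇) (λ { refl → refl }) (a ≟ b)

⊔-split : {v a b c : Expr n} → v ≤ a ⊔ b → v ⊓ a ≤ c → v ⊓ b ≤ c → v ≤ c
⊔-split p q r = trans (⊓-glb refl p) (trans distr (⊔-lub q r))

⋂ : List (Expr n) → Expr n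
⋂ [] = ⊤ᵉ
⋂ (x ∷ xs) = x ⊓ ⋂ xs

⋂-lower : {xs : List (Expr n)} {x : Expr n} → x ∈ xs → ⋂ xs ≤ x
⋂-lower (here refl) = ⊓-l
⋂-lower (there x∈) = trans ⊓-r (⋂-lower x∈)

⋂-greatest : {v : Expr n} (xs : List (Expr n)) → (∀ {x} → x ∈ xs → v ≤ x) → v ≤ ⋂ xs
⋂-greatest [] h = ≤⊤
⋂-greatest (x ∷ xs) h = ⊓-glb (h (here refl)) (⋂-greatest xs (λ x∈ → h (there x∈)))

-- The core is `𝟙 ⊓ (⊤ᵉ ⋆ x) ≤ x`, an instance of `⋆-⊓-left`. Since `v` lies below both `g ⋆ 𝟙` and
-- `g ⋆ (⊤ᵉ ⋆ x)`, `⋆-distr-⊓` lets the core act behind `g`.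
junk-sound : {v g x : Expr n} → v ≤ g → v ≤ ⊤ᵉ ⋆ x → v ≤ g ⋆ x
junk-sound v≤g v≤x =
  trans (⊓-glb (trans v≤g unitʳ-≥) (trans v≤x (trans (⋆-mono ⋆-top refl) assoc-≥)))
  (trans ⋆-distr-⊓ (⋆-mono refl (trans (⊓-glb ⊓-r ⊓-l)
  (trans ⋆-⊓-left (trans (⋆-mono ⊓-r refl) unitˡ-≤)))))

𝟙↛ : {t : Expr n} → ¬ 𝟙 ⟶ t
𝟙↛ ()

step-∃ : {e e′ : Expr n} → e ⟶ e′ → pol e ≡ ∃ₚ → e′ ≤ e
step-∃ ⊔-l _ = ⊔-inl
step-∃ ⊔-r _ = ⊔-inr
step-∃ ⋆-𝟙 _ = unitʳ-≥
step-∃ ◇-𝟙 _ = ◇-unit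
step-∃ ◇-un _ = ◇-unfold
step-∃ (⋆-ctx s) p = ⋆-mono refl (step-∃ s p)

step-? : {a : Fin n} {e e′ : Expr n} → e ⟶ e′ → pol e ≡ ?ₚ a → e′ ⋆ lit a ≤ e
step-? lit refl = unitˡ-≤
step-? (⋆-ctx s) p = trans assoc-≥ (⋆-mono refl (step-? s p))

-- As `v` need not have the form `g ⋆ w`, a recursion under `⋆` cannot carry it along. The recursion
-- runs in `cover` instead, which bounds `e` from below by `⊤ᵉ` or by a meet of two successors; both
-- bounds pass through `g ⋆_`.
step-∀ : {v : Expr n} (e : Expr n) → pol e ≡ ∀ₚ → (∀ {e′} → e ⟶ e′ → v ≤ e′) → v ≤ e
step-∀ {v = v} e p h with cover e p
  where
  cover : (e : Expr n) → pol e ≡ ∀ₚ →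
          ⊤ᵉ ≤ e ⊎ ∃ λ x → ∃ λ y → e ⟶ x × e ⟶ y × x ⊓ y ≤ e
  cover ⊤ᵉ _ = inj₁ refl
  cover (e ⊓ f) _ = inj₂ (e , f , ⊓-l , ⊓-r , refl)
  cover (g ⋆ e) p with cover e p
  ... | inj₁ ⊤≤ = inj₁ (trans ⋆-top (⋆-mono refl ⊤≤))
  ... | inj₂ (x , y , sx , sy , le) =
    inj₂ (g ⋆ x , g ⋆ y , ⋆-ctx sx , ⋆-ctx sy , trans ⋆-distr-⊓ (⋆-mono refl le))
... | inj₁ ⊤≤ = trans ≤⊤ ⊤≤
... | inj₂ (x , y , sx , sy , le) = trans (⊓-glb (h sx) (h sy)) le

-- Successors and finite sets closed under transitions

succs : Expr n → List (Expr n)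
succs (lit a) = 𝟙 ∷ []
succs 𝟘 = []
succs ⊤ᵉ = []
succs 𝟙 = []
succs (e ⊔ f) = e ∷ f ∷ []
succs (e ⊓ f) = e ∷ f ∷ []
succs (g ⋆ e) = map (g ⋆_) (succs e) ++ (if does (e ≟ 𝟙) then g ∷ [] else [])
succs (e ◇) = 𝟙 ∷ e ◇ ⋆ e ∷ []

succs-complete : {e e′ : Expr n} → e ⟶ e′ → e′ ∈ succs e
succs-complete ⊔-l = here refl
succs-complete ⊔-r = there (here refl)
succs-complete ⊓-l = here refl
succs-complete ⊓-r = there (here refl)
succs-complete lit = here refl
succs-complete ⋆-𝟙 = here refl
succs-complete ◇-𝟙 = here refl
succs-complete ◇-un = there (here refl)
succs-complete (⋆-ctx s) = ∈-++⁺ˡ (∈-map⁺ _ (succs-complete s))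

succs-sound : (e : Expr n) {e′ : Expr n} → e′ ∈ succs e → e ⟶ e′
succs-sound (lit a) (here refl) = lit
succs-sound (e ⊔ f) (here refl) = ⊔-l
succs-sound (e ⊔ f) (there (here refl)) = ⊔-r
succs-sound (e ⊓ f) (here refl) = ⊓-l
succs-sound (e ⊓ f) (there (here refl)) = ⊓-r
succs-sound (e ◇) (here refl) = ◇-𝟙
succs-sound (e ◇) (there (here refl)) = ◇-un
succs-sound (g ⋆ e) m with ∈-++⁻ (map (g ⋆_) (succs e)) m
... | inj₁ m′ with ∈-map⁻ (g ⋆_) m′
...   | _ , m″ , refl = ⋆-ctx (succs-sound e m″)
succs-sound (g ⋆ e) m | inj₂ m′ with e ≟ 𝟙 | m′
... | yes refl | here refl = ⋆-𝟙

-- Transitions of `g ⋆ e` act inside `e` until it has become `𝟙`, and then `g` takes over. A loop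
-- body runs behind the fixed left factor `e ◇` and returns to `e ◇`, so the set is finite although
-- `◇-un` makes expressions grow.
closure : Expr n → List (Expr n)
closure (lit a) = lit a ∷ 𝟙 ∷ []
closure 𝟘 = 𝟘 ∷ []
closure ⊤ᵉ = ⊤ᵉ ∷ []
closure 𝟙 = 𝟙 ∷ []
closure (e ⊔ f) = e ⊔ f ∷ closure e ++ closure f
closure (e ⊓ f) = e ⊓ f ∷ closure e ++ closure f
closure (g ⋆ e) = map (g ⋆_) (closure e) ++ closure g
closure (e ◇) = e ◇ ∷ 𝟙 ∷ map (e ◇ ⋆_) (closure e)

self∈closure : (e : Expr n) → e ∈ closure e
self∈closure (lit a) = here refl
self∈closure 𝟘 = here refl
self∈closure ⊤ᵉ = here refl
self∈closure 𝟙 = here refl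
self∈closure (e ⊔ f) = here refl
self∈closure (e ⊓ f) = here refl
self∈closure (g ⋆ e) = ∈-++⁺ˡ (∈-map⁺ _ (self∈closure e))
self∈closure (e ◇) = here refl

Closed : List (Expr n) → Set
Closed U = ∀ {e e′} → e ∈ U → e ⟶ e′ → e′ ∈ U

closure-closed : (e : Expr n) → Closed (closure e)
closure-closed (lit a) (here refl) lit = there (here refl)
closure-closed (lit a) (there (here refl)) ()
closure-closed 𝟘 (here refl) ()
closure-closed ⊤ᵉ (here refl) ()
closure-closed 𝟙 (here refl) ()
closure-closed (e ⊔ f) (here refl) ⊔-l = there (∈-++⁺ˡ (self∈closure e))
closure-closed (e ⊔ f) (here refl) ⊔-r = there (∈-++⁺ʳ (closure e) (self∈closure f))
closure-closed (e ⊔ f) (there x∈) s with ∈-++⁻ (closure e) x∈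
... | inj₁ x∈e = there (∈-++⁺ˡ (closure-closed e x∈e s))
... | inj₂ x∈f = there (∈-++⁺ʳ (closure e) (closure-closed f x∈f s))
closure-closed (e ⊓ f) (here refl) ⊓-l = there (∈-++⁺ˡ (self∈closure e))
closure-closed (e ⊓ f) (here refl) ⊓-r = there (∈-++⁺ʳ (closure e) (self∈closure f))
closure-closed (e ⊓ f) (there x∈) s with ∈-++⁻ (closure e) x∈
... | inj₁ x∈e = there (∈-++⁺ˡ (closure-closed e x∈e s))
... | inj₂ x∈f = there (∈-++⁺ʳ (closure e) (closure-closed f x∈f s))
closure-closed (g ⋆ e) x∈ s with ∈-++⁻ (map (g ⋆_) (closure e)) x∈
... | inj₂ x∈g = ∈-++⁺ʳ (map (g ⋆_) (closure e)) (closure-closed g x∈g s)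
... | inj₁ x∈e with ∈-map⁻ (g ⋆_) x∈e | s
...   | _ , _ , refl | ⋆-𝟙 = ∈-++⁺ʳ (map (g ⋆_) (closure e)) (self∈closure g)
...   | _ , y∈ , refl | ⋆-ctx s′ = ∈-++⁺ˡ (∈-map⁺ _ (closure-closed e y∈ s′))
closure-closed (e ◇) (here refl) ◇-𝟙 = there (here refl)
closure-closed (e ◇) (here refl) ◇-un = there (there (∈-map⁺ _ (self∈closure e)))
closure-closed (e ◇) (there (here refl)) ()
closure-closed (e ◇) (there (there x∈)) s with ∈-map⁻ (e ◇ ⋆_) x∈ | s
... | _ , _ , refl | ⋆-𝟙 = here refl
... | _ , y∈ , refl | ⋆-ctx s′ = there (there (∈-map⁺ _ (closure-closed e y∈ s′)))

concatMap-closure-closed : (es : List (Expr n)) → Closed (concatMap closure es)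
concatMap-closure-closed es x∈ s =
  ∈-concatMap⁺ closure (Any.map (λ {e} x∈e → closure-closed e x∈e s) (∈-concatMap⁻ closure {xs = es} x∈))

-- Decidable solution of the game

module _ {A : Set} {P Q : A → Set} (P? : Decidable P) (Q? : Decidable Q) where

  length-filter-mono : ∀ xs → (∀ {x} → x ∈ xs → P x → Q x) →
                       length (filter P? xs) ≤ℕ length (filter Q? xs)
  length-filter-mono [] h = z≤n
  length-filter-mono (x ∷ xs) h with P? x | Q? x
  ... | yes p | yes q = s≤s (length-filter-mono xs (h ∘ there))
  ... | yes p | no ¬q = contradiction (h (here refl) p) ¬q
  ... | no ¬p | yes q = ℕₚ.m≤n⇒m≤1+n (length-filter-mono xs (h ∘ there))
  ... | no ¬p | no ¬q = length-filter-mono xs (h ∘ there)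

  length-filter-strict : ∀ {xs x} → (∀ {x} → x ∈ xs → P x → Q x) → x ∈ xs → ¬ P x → Q x →
                         length (filter P? xs) <ℕ length (filter Q? xs)
  length-filter-strict {x ∷ xs} h (here refl) ¬p q with P? x | Q? x
  ... | yes p | _ = contradiction p ¬p
  ... | no _ | yes _ = s≤s (length-filter-mono xs (h ∘ there))
  ... | no _ | no ¬q = contradiction q ¬q
  length-filter-strict {y ∷ xs} h (there x∈) ¬p q with P? y | Q? y
  ... | yes _ | yes _ = s≤s (length-filter-strict (h ∘ there) x∈ ¬p q)
  ... | yes p | no ¬q = contradiction (h (here refl) p) ¬q
  ... | no _ | yes _ = ℕₚ.m≤n⇒m≤1+n (length-filter-strict (h ∘ there) x∈ ¬p q)
  ... | no _ | no _ = length-filter-strict (h ∘ there) x∈ ¬p q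

-- Abstract, since unfolding the search when comparing iterates is prohibitively expensive.
abstract
  descending-stabilises : {A : Set} (xs : List A) (P : ℕ → A → Set) → (∀ k → Decidable (P k)) →
    (∀ k {x} → x ∈ xs → P (suc k) x → P k x) →
    ∃ λ k → ∀ {x} → x ∈ xs → P k x → P (suc k) x
  descending-stabilises xs P P? anti = go 0 (<-wellFounded _)
    where
    go : ∀ k → Acc _<ℕ_ (length (filter (P? k) xs)) → ∃ λ k → ∀ {x} → x ∈ xs → P k x → P (suc k) x
    go k (acc rs) with all? (λ x → P? k x →-dec P? (suc k) x) xs
    ... | yes stable = k , λ x∈ → All.lookup stable x∈
    ... | no unstable with find (¬All⇒Any¬ (λ x → P? k x →-dec P? (suc k) x) xs unstable)
    ...   | x , x∈ , ¬imp =
      go (suc k) (rs (length-filter-strict (P? (suc k)) (P? k) (anti k) x∈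
        (λ p → ¬imp (λ _ → p))
        (decidable-stable (P? k x) (λ ¬p → ¬imp (λ p → contradiction p ¬p)))))

-- Finite enumerations and decidability for the arena

sublists : {A : Set} → List A → List (List A)
sublists [] = [] ∷ []
sublists (x ∷ xs) = map (x ∷_) (sublists xs) ++ sublists xs

filter∈sublists : {A : Set} {P : A → Set} (P? : Decidable P) (xs : List A) → filter P? xs ∈ sublists xs
filter∈sublists P? [] = here refl
filter∈sublists P? (x ∷ xs) with P? x
... | yes _ = ∈-++⁺ˡ (∈-map⁺ _ (filter∈sublists P? xs))
... | no _ = ∈-++⁺ʳ (map (x ∷_) (sublists xs)) (filter∈sublists P? xs)

subsets : ∀ n → List (Subset n)
subsets zero = [] ∷ []
subsets (suc n) = map (inside ∷_) (subsets n) ++ map (outside ∷_) (subsets n)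

∈-subsets : (p : Subset n) → p ∈ subsets n
∈-subsets [] = here refl
∈-subsets (true ∷ p) = ∈-++⁺ˡ (∈-map⁺ _ (∈-subsets p))
∈-subsets {suc n} (false ∷ p) = ∈-++⁺ʳ (map (inside ∷_) (subsets n)) (∈-map⁺ _ (∈-subsets p))

infix 4 _∈?_

_∈?_ : (e : Expr n) (X : List (Expr n)) → Dec (e ∈ X)
_∈?_ = DecMembership._∈?_ _≟_

quant? : (p : Pol n) → Dec (Quant p)
quant? ∃ₚ = yes (inj₁ refl)
quant? ∀ₚ = yes (inj₂ refl)
quant? (?ₚ a) = no λ { (inj₁ ()) ; (inj₂ ()) }

blocking? : (X : List (Expr n)) → Dec (Blocking X)
blocking? X = map′ (λ b → find b) (λ { (t , t∈ , b) → lose t∈ b })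
  (any? (λ t → ¬? (t ≟ 𝟙) ×-dec quant? (pol t)) X)

_∖_ : List (Expr n) → Expr n → List (Expr n)
X ∖ t = filter (λ y → ¬? (y ≟ t)) X

-- Lists X are normalised to filtrations of a fixed list U, which leaves finitely many
-- positions with goal in V.
module Arena {n : ℕ} (U V : List (Expr n)) where

  norm : List (Expr n) → List (Expr n)
  norm X = filter (_∈? X) U

  norm-cong : {X Y : List (Expr n)} → X ⊆ Y → Y ⊆ X → norm X ≡ norm Y
  norm-cong {X} {Y} X⊆Y Y⊆X = filter-≐ (_∈? X) (_∈? Y) (X⊆Y , Y⊆X) U

  norm⊆ : {X : List (Expr n)} → norm X ⊆ X
  norm⊆ {X} y∈ = proj₂ (∈-filter⁻ (_∈? X) {xs = U} y∈)

  norm⊆U : {X : List (Expr n)} → norm X ⊆ U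
  norm⊆U {X} y∈ = proj₁ (∈-filter⁻ (_∈? X) {xs = U} y∈)

  ⊆norm : {X : List (Expr n)} {y : Expr n} → y ∈ U → y ∈ X → y ∈ norm X
  ⊆norm {X} = ∈-filter⁺ (_∈? X)

  norm-idem : (X : List (Expr n)) → X ⊆ U → norm (norm X) ≡ norm X
  norm-idem X X⊆U = norm-cong norm⊆ (λ y∈ → ⊆norm (X⊆U y∈) y∈)

  _[_≔_] : List (Expr n) → Expr n → List (Expr n) → List (Expr n)
  X [ t ≔ ts ] = norm (ts ++ X ∖ t)

  Normal : Pos n → Set
  Normal p = norm (X p) ≡ X p × goal p ∈ V

  normal? : Decidable Normal
  normal? p = ≡-dec _≟_ (norm (X p)) (X p) ×-dec (goal p ∈? V)

  positions : List (Pos n)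
  positions = cartesianProductWith (λ Γ (X , e) → ⟨ Γ ∣ X ⊢ e ⟩) (subsets n) (cartesianProduct (sublists U) V)

  ∈-positions : {p : Pos n} → Normal p → p ∈ positions
  ∈-positions {⟨ Γ ∣ X ⊢ e ⟩} (eq , e∈) =
    ∈-cartesianProductWith⁺ _ (∈-subsets Γ)
      (∈-cartesianProduct⁺ (subst (_∈ sublists U) eq (filter∈sublists (_∈? X) U)) e∈)

  -- The polarity is an argument of its own, so that proofs can match on it while keeping an
  -- equation `pol t ≡ π`. For `𝟙`, which has no successors, the condition is vacuous.
  Respond : (Pos n → Set) → Pos n → Expr n → Pol n → Set
  Respond Z ⟨ Γ ∣ X ⊢ e ⟩ t ∃ₚ = All (λ t′ → Z ⟨ Γ ∣ X [ t ≔ t′ ∷ [] ] ⊢ e ⟩) (succs t)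
  Respond Z ⟨ Γ ∣ X ⊢ e ⟩ t ∀ₚ = Z ⟨ Γ ∣ X [ t ≔ succs t ] ⊢ e ⟩
  Respond Z ⟨ Γ ∣ X ⊢ e ⟩ t (?ₚ _) = ⊤

  Fill : (Pos n → Set) → Pos n → Fin n → Expr n → Set
  Fill R ⟨ Γ ∣ X ⊢ e ⟩ a t =
    pol t ≡ ?ₚ a × Any (λ t′ → Any (λ e′ → R ⟨ Γ ∪ˢ ⁅ a ⁆ ∣ X [ t ≔ t′ ∷ [] ] ⊢ e′ ⟩) (succs e)) (succs t)

  Advance : (Pos n → Set) → Pos n → Pol n → Set
  Advance R ⟨ Γ ∣ X ⊢ e ⟩ ∀ₚ = All (λ e′ → R ⟨ Γ ∣ X ⊢ e′ ⟩) (succs e)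
  Advance R ⟨ Γ ∣ X ⊢ e ⟩ ∃ₚ = Any (λ e′ → R ⟨ Γ ∣ X ⊢ e′ ⟩) (succs e)
  Advance R p@(⟨ Γ ∣ X ⊢ e ⟩) (?ₚ a) =
    (a ∈ˢ Γ × Any (λ e′ → R ⟨ Γ ∣ X ⊢ e′ ⟩) (succs e)) ⊎ Any (Fill R p a) X

  -- Z is what must hold after a Spoiler move on the left, R after any other move.
  Step : (Pos n → Set) → (Pos n → Set) → Pos n → Set
  Step Z R p = (Blocking (X p) → All (λ t → Respond Z p t (pol t)) (X p))
             × (¬ Blocking (X p) → Advance R p (pol (goal p)))

  respond? : {Z : Pos n → Set} → Decidable Z → ∀ p t π → Dec (Respond Z p t π)
  respond? Z? ⟨ Γ ∣ X ⊢ e ⟩ t ∃ₚ = all? (λ t′ → Z? _) (succs t)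
  respond? Z? ⟨ Γ ∣ X ⊢ e ⟩ t ∀ₚ = Z? _
  respond? Z? ⟨ Γ ∣ X ⊢ e ⟩ t (?ₚ _) = yes tt

  polIs? : ∀ (π : Pol n) a → Dec (π ≡ ?ₚ a)
  polIs? ∃ₚ a = no λ ()
  polIs? ∀ₚ a = no λ ()
  polIs? (?ₚ b) a = map′ (cong ?ₚ) (λ { refl → refl }) (b Finₚ.≟ a)

  advance? : {R : Pos n → Set} → Decidable R → ∀ p π → Dec (Advance R p π)
  advance? R? ⟨ Γ ∣ X ⊢ e ⟩ ∀ₚ = all? (λ e′ → R? _) (succs e)
  advance? R? ⟨ Γ ∣ X ⊢ e ⟩ ∃ₚ = any? (λ e′ → R? _) (succs e)
  advance? R? ⟨ Γ ∣ X ⊢ e ⟩ (?ₚ a) =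
    ((a ∈ˢ? Γ) ×-dec any? (λ e′ → R? _) (succs e))
    ⊎-dec any? (λ t → polIs? (pol t) a ×-dec any? (λ t′ → any? (λ e′ → R? _) (succs e)) (succs t)) X

  step? : {Z R : Pos n → Set} → Decidable Z → Decidable R → Decidable (Step Z R)
  step? Z? R? p =
    (blocking? (X p) →-dec all? (λ t → respond? Z? p t (pol t)) (X p))
    ×-dec (¬? (blocking? (X p)) →-dec advance? R? p (pol (goal p)))

  respond-mono : {Z Z′ : Pos n → Set} → (∀ {p} → Z p → Z′ p) → ∀ p t π → Respond Z p t π → Respond Z′ p t π
  respond-mono Z⊆ ⟨ Γ ∣ X ⊢ e ⟩ t ∃ₚ = All.map Z⊆
  respond-mono Z⊆ ⟨ Γ ∣ X ⊢ e ⟩ t ∀ₚ = Z⊆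
  respond-mono Z⊆ ⟨ Γ ∣ X ⊢ e ⟩ t (?ₚ _) = _

  advance-mono : {R R′ : Pos n → Set} → (∀ {p} → R p → R′ p) → ∀ p π → Advance R p π → Advance R′ p π
  advance-mono R⊆ ⟨ Γ ∣ X ⊢ e ⟩ ∀ₚ = All.map R⊆
  advance-mono R⊆ ⟨ Γ ∣ X ⊢ e ⟩ ∃ₚ = Any.map R⊆
  advance-mono R⊆ ⟨ Γ ∣ X ⊢ e ⟩ (?ₚ a) =
    Sum.map (Product.map₂ (Any.map R⊆)) (Any.map (Product.map₂ (Any.map (Any.map R⊆))))

  step-mono : {Z Z′ R R′ : Pos n → Set} → (∀ {p} → Z p → Z′ p) → (∀ {p} → R p → R′ p) →
              ∀ {p} → Step Z R p → Step Z′ R′ p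
  step-mono Z⊆ R⊆ {p} (l , r) =
    (λ b → All.map (λ {t} → respond-mono Z⊆ p t (pol t)) (l b)) ,
    (λ ¬b → advance-mono R⊆ p (pol (goal p)) (r ¬b))

  DecPred : Set₁
  DecPred = Σ (Pos n → Set) Decidable

  -- At stage `k` Duplicator can force, after fewer than `k` right-hand moves, a blocking position
  -- whose left moves all lead into `Z`, or a goal of polarity ∀ without successors. Decision
  -- procedures accompany the predicates, so that no classical reasoning is required.
  μ-iter : DecPred → ℕ → DecPred
  μ-iter Z zero = (λ _ → ⊥) , λ _ → no λ ()
  μ-iter Z (suc k) =
    (λ p → Normal p × Step (proj₁ Z) (proj₁ (μ-iter Z k)) p) ,
    (λ p → normal? p ×-dec step? (proj₂ Z) (proj₂ (μ-iter Z k)) p)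

  Rank : DecPred → ℕ → Pos n → Set
  Rank Z k = proj₁ (μ-iter Z k)

  rank-suc : ∀ Z k {p} → Rank Z k p → Rank Z (suc k) p
  rank-suc Z (suc k) (nf , s) = nf , step-mono (λ z → z) (rank-suc Z k) s

  -- The stages of a least fixpoint grow; it is their complements that descend.
  μ-stable : ∀ Z → ∃ λ k → ∀ {p} → p ∈ positions → ¬ Rank Z k p → ¬ Rank Z (suc k) p
  μ-stable Z = descending-stabilises positions (λ k p → ¬ Rank Z k p)
    (λ k p → ¬? (proj₂ (μ-iter Z k) p)) (λ k _ ¬r r → ¬r (rank-suc Z k r))

  μ : DecPred → DecPred
  μ Z = μ-iter Z (proj₁ (μ-stable Z))

  μ-closed : ∀ Z {p} → Normal p → Step (proj₁ Z) (proj₁ (μ Z)) p → proj₁ (μ Z) p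
  μ-closed Z {p} nf s = decidable-stable (proj₂ (μ Z) p)
    (λ ¬r → proj₂ (μ-stable Z) (∈-positions nf) ¬r (nf , s))

  μ-mono : ∀ Z Z′ → (∀ {p} → proj₁ Z p → proj₁ Z′ p) → ∀ {p} → proj₁ (μ Z) p → proj₁ (μ Z′) p
  μ-mono Z Z′ Z⊆ = go (proj₁ (μ-stable Z))
    where
    go : ∀ k {p} → Rank Z k p → proj₁ (μ Z′) p
    go (suc k) (nf , s) = μ-closed Z′ nf (step-mono Z⊆ (go k) s)

  ν-iter : ℕ → DecPred
  ν-iter zero = (λ _ → ⊤) , λ _ → yes tt
  ν-iter (suc j) = μ (ν-iter j)

  ν-anti : ∀ j {p} → proj₁ (ν-iter (suc j)) p → proj₁ (ν-iter j) p
  ν-anti zero _ = tt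
  ν-anti (suc j) = μ-mono (ν-iter (suc j)) (ν-iter j) (ν-anti j)

  ν-stable : ∃ λ j → ∀ {p} → p ∈ positions → proj₁ (ν-iter j) p → proj₁ (ν-iter (suc j)) p
  ν-stable = descending-stabilises positions (λ j → proj₁ (ν-iter j)) (λ j → proj₂ (ν-iter j))
    (λ j _ → ν-anti j)

  winning : DecPred
  winning = ν-iter (proj₁ ν-stable)

  W : Pos n → Set
  W = proj₁ winning

  -- The round of `ν-iter` after the stable index is `μ winning`, so membership in `W` can be reread
  -- as a finite rank whose left moves lead into `W` again.
  W-rank : ∀ {p} → Normal p → W p → ∃ λ k → Rank winning k p
  W-rank nf w = proj₁ (μ-stable winning) , proj₂ ν-stable (∈-positions nf) w

  rank⇒W : ∀ k {p} → Rank winning k p → W p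
  rank⇒W k r = ν-anti (proj₁ ν-stable) (go k r)
    where
    go : ∀ k {p} → Rank winning k p → proj₁ (μ winning) p
    go (suc k) (nf , s) = μ-closed winning nf (step-mono (λ z → z) (go k) s)

∈-∖⁺ : ∀ {n} {X : List (Expr n)} {t y : Expr n} → y ∈ X → y ≢ t → y ∈ X ∖ t
∈-∖⁺ = ∈-filter⁺ (λ y → ¬? (y ≟ _))

∈-∖⁻ : ∀ {n} {X : List (Expr n)} {t y : Expr n} → y ∈ X ∖ t → y ∈ X × y ≢ t
∈-∖⁻ {X = X} = ∈-filter⁻ (λ y → ¬? (y ≟ _)) {xs = X}

-- Duplicator's given strategy wins from p₀, hence it stays in the winning region W: outside
-- of it Spoiler could steer a play of the strategy through non-winning positions forever.
module Strategy {n : ℕ} (U V : List (Expr n)) (U-closed : Closed U) (V-closed : Closed V)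
                {p₀ : Pos n} (ws : WinningStrategy p₀) (X₀⊆U : X p₀ ⊆ U) (goal₀∈V : goal p₀ ∈ V) where

  open Arena U V
  open WinningStrategy ws

  normPos : Pos n → Pos n
  normPos p = ⟨ Γ p ∣ norm (X p) ⊢ goal p ⟩

  -- `S` is not assumed closed under prefixes, so a play records the membership of each of its
  -- prefixes.
  data Play : Pos n → History n → Set where
    initial : Play p₀ []
    move    : ∀ {p q h} → Play p h → Move p q → S (q ∷ p ∷ h) → Play q (p ∷ h)

  play⇒S : ∀ {p h} → Play p h → S (p ∷ h)
  play⇒S initial = start
  play⇒S (move _ _ s) = s

  -- Moves up to equality of sets

  Updates : List (Expr n) → Expr n → List (Expr n) → List (Expr n) → Set
  Updates X t ts Y = Represents Y (λ y → (y ∈ X × y ≢ t) ⊎ y ∈ ts)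

  ++∖-updates : ∀ X t ts → Updates X t ts (ts ++ X ∖ t)
  ++∖-updates X t ts y =
    (λ y∈ → [ inj₂ , inj₁ ∘ ∈-∖⁻ {X = X} ]′ (∈-++⁻ ts y∈)) ,
    [ (λ (y∈ , y≢) → ∈-++⁺ʳ ts (∈-∖⁺ y∈ y≢)) , ∈-++⁺ˡ ]′

  replace⇒updates : ∀ {X t t′ Y} → Replace X t t′ Y → Updates X t (t′ ∷ []) Y
  replace⇒updates r y =
    (λ y∈ → [ inj₁ , (λ { refl → inj₂ (here refl) }) ]′ (proj₁ (r y) y∈)) ,
    [ proj₂ (r y) ∘ inj₁ , (λ { (here refl) → proj₂ (r y) (inj₂ refl) }) ]′

  updates⇒replace : ∀ {X t t′ Y} → Updates X t (t′ ∷ []) Y → Replace X t t′ Y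
  updates⇒replace u y =
    (λ y∈ → [ inj₁ , (λ { (here refl) → inj₂ refl }) ]′ (proj₁ (u y) y∈)) ,
    [ proj₂ (u y) ∘ inj₁ , (λ { refl → proj₂ (u y) (inj₂ (here refl)) }) ]′

  updates⇒fork : ∀ {X t Y} → Updates X t (succs t) Y → ForkSet X t Y
  updates⇒fork {t = t} u y =
    (λ y∈ → [ inj₁ , inj₂ ∘ succs-sound t ]′ (proj₁ (u y) y∈)) ,
    [ proj₂ (u y) ∘ inj₁ , proj₂ (u y) ∘ inj₂ ∘ succs-complete ]′

  updates⊆U : ∀ {X t ts Y} → X ⊆ U → ts ⊆ U → Updates X t ts Y → Y ⊆ U
  updates⊆U X⊆U ts⊆U u {y} y∈ = [ X⊆U ∘ proj₁ , ts⊆U ]′ (proj₁ (u y) y∈)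

  -- A move determines its new list only as a set. After normalisation every admissible `Y` becomes
  -- the canonical update, so facts about `W` transfer to whatever list the strategy chooses.
  norm-updates : ∀ {X t ts Y} → X ⊆ U → Updates X t ts Y → norm Y ≡ norm X [ t ≔ ts ]
  norm-updates {X} {t} {ts} X⊆U u = norm-cong
    (λ {y} y∈ → [ (λ (y∈X , y≢) → ∈-++⁺ʳ ts (∈-∖⁺ (⊆norm (X⊆U y∈X) y∈X) y≢)) , ∈-++⁺ˡ ]′ (proj₁ (u y) y∈))
    (λ {y} y∈ → proj₂ (u y) ([ inj₂ , (λ y∈′ → let (y∈X , y≢) = ∈-∖⁻ {X = norm X} y∈′ in inj₁ (norm⊆ y∈X , y≢)) ]′
      (∈-++⁻ ts y∈)))

  move⊆ : ∀ {p q} → Move p q → X p ⊆ U → goal p ∈ V → X q ⊆ U × goal q ∈ V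
  move⊆ (explore t∈ _ s r) X⊆ g∈ =
    updates⊆U X⊆ (λ { (here refl) → U-closed (X⊆ t∈) s }) (replace⇒updates r) , g∈
  move⊆ (fork t∈ _ f) X⊆ g∈ = (λ {y} y∈ → [ X⊆ ∘ proj₁ , U-closed (X⊆ t∈) ]′ (proj₁ (f y) y∈)) , g∈
  move⊆ (alea (alea _ _ s)) X⊆ g∈ = X⊆ , V-closed g∈ s
  move⊆ (choose _ _ s) X⊆ g∈ = X⊆ , V-closed g∈ s
  move⊆ (junk _ _ _ s) X⊆ g∈ = X⊆ , V-closed g∈ s
  move⊆ (fill _ _ t∈ _ s s′ r) X⊆ g∈ =
    updates⊆U X⊆ (λ { (here refl) → U-closed (X⊆ t∈) s′ }) (replace⇒updates r) , V-closed g∈ s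

  play⊆ : ∀ {p h} → Play p h → X p ⊆ U × goal p ∈ V
  play⊆ initial = X₀⊆U , goal₀∈V
  play⊆ (move pl m _) = let (X⊆ , g∈) = play⊆ pl in move⊆ m X⊆ g∈

  -- Infinite continuations of a play

  histories : (ℕ → Pos n) → History n → ℕ → History n
  histories σ h zero = σ zero ∷ h
  histories σ h (suc i) = σ (suc i) ∷ histories σ h i

  _◂_ : Pos n → (ℕ → Pos n) → ℕ → Pos n
  (p ◂ σ) zero = p
  (p ◂ σ) (suc i) = σ i

  histories-◂ : ∀ p σ h i → histories (p ◂ σ) h (suc i) ≡ histories σ (p ∷ h) i
  histories-◂ p σ h zero = refl
  histories-◂ p σ h (suc i) = cong (σ (suc i) ∷_) (histories-◂ p σ h i)

  prefix≡histories : ∀ σ i → prefix σ i ≡ histories σ [] i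
  prefix≡histories σ zero = refl
  prefix≡histories σ (suc i) = cong (σ (suc i) ∷_) (prefix≡histories σ i)

  -- `infinite-win` speaks only of plays from `p₀`, so the history is put back in front one position
  -- at a time. Those positions may be winning, which is why the bound `k` is arbitrary: it grows
  -- past each of them.
  no-losing-continuation : ∀ {p h} → Play p h → (σ : ℕ → Pos n) → σ zero ≡ p →
    (∀ i → Move (σ i) (σ (suc i))) → (∀ i → S (histories σ h i)) →
    ∀ k → ¬ (∀ i → k ≤ℕ i → ¬ Winning (σ i))
  no-losing-continuation initial σ eq mv inS k lost =
    let (m , k≤m , w) = infinite-win σ eq mv (λ i → subst S (sym (prefix≡histories σ i)) (inS i)) k
    in lost m k≤m w
  no-losing-continuation {h = p ∷ h} (move pl m _) σ refl mv inS k lost =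
    no-losing-continuation pl (p ◂ σ) refl
      (λ { zero → m ; (suc i) → mv i })
      (λ { zero → play⇒S pl ; (suc i) → subst S (sym (histories-◂ p σ h i)) (inS i) })
      (suc k) (λ { (suc i) (s≤s k≤i) → lost i k≤i })

  module _ (j : ℕ) (safe : ∀ {p h} → Play p h → proj₁ (ν-iter j) (normPos p)) where

    R : Pos n → Set
    R = proj₁ (ν-iter (suc j))

    Trapped : Set
    Trapped = ∃ λ p → ∃ λ h → Play p h × ¬ R (normPos p)

    Escape : Trapped → Set
    Escape (p , h , _) = ¬ Winning p × ∃ λ q → Move p q × Play q (p ∷ h) × ¬ R (normPos q)

    respond : ∀ {p h} → Play p h → ∀ {t} → t ∈ norm (X p) → Blocking (X p) →
              ∀ π → pol t ≡ π → Respond (proj₁ (ν-iter j)) (normPos p) t π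
    respond {p} pl {t} t∈ b ∃ₚ eq = All.tabulate λ {t′} t′∈ →
      let u = ++∖-updates (X p) t (t′ ∷ [])
          m = explore (norm⊆ t∈) eq (succs-sound t t′∈) (updates⇒replace u)
      in subst (λ Y → proj₁ (ν-iter j) ⟨ Γ p ∣ Y ⊢ goal p ⟩) (norm-updates (proj₁ (play⊆ pl)) u)
           (safe (move pl m (spoiler (play⇒S pl) (inj₁ b) m)))
    respond {p} pl {t} t∈ b ∀ₚ eq =
      let u = ++∖-updates (X p) t (succs t)
          m = fork (norm⊆ t∈) eq (updates⇒fork u)
      in subst (λ Y → proj₁ (ν-iter j) ⟨ Γ p ∣ Y ⊢ goal p ⟩) (norm-updates (proj₁ (play⊆ pl)) u)
           (safe (move pl m (spoiler (play⇒S pl) (inj₁ b) m)))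
    respond pl t∈ b (?ₚ _) eq = tt

    -- At a blocking position every left move is Spoiler's and stays in stage `j` by `safe`, so
    -- `Step` would hold. A trapped position is therefore not blocking, and the failure of `Advance`
    -- either supplies a bad ALEA move or makes every move of Duplicator bad. Neither kind of
    -- position is winning.
    escape : (s : Trapped) → Escape s
    escape (p@(⟨ Γ ∣ X ⊢ e ⟩) , h , pl , ¬r) = go (blocking? (norm X))
      where
      X⊆U = proj₁ (play⊆ pl)

      step⇒⊥ : ¬ Step (proj₁ (ν-iter j)) R (normPos p)
      step⇒⊥ s = ¬r (μ-closed (ν-iter j) (norm-idem X X⊆U , proj₂ (play⊆ pl)) s)

      go : Dec (Blocking (norm X)) → Escape (p , h , pl , ¬r)
      go (yes b@(t , t∈ , nb)) = contradiction
        ((λ _ → All.tabulate (λ {t′} t′∈ → respond pl t′∈ (t , norm⊆ t∈ , nb) (pol t′) refl)) ,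
         (λ ¬b → contradiction b ¬b)) step⇒⊥
      go (no ¬b) = aim (pol e) refl (λ adv → step⇒⊥ ((λ b → contradiction b ¬b) , (λ _ → adv)))
        where
        ¬blocking : ¬ Blocking X
        ¬blocking (t , t∈ , nb) = ¬b (t , ⊆norm (X⊆U t∈) t∈ , nb)

        duplicates : ∀ π → pol e ≡ π → π ≢ ∀ₚ → ¬ Advance R (normPos p) π → Escape (p , h , pl , ¬r)
        duplicates π eq π≢∀ ¬adv = (λ w → existsPos (proj₁ w)) , turn (duplicator (play⇒S pl) existsPos)
          where
          existsPos : ExistsPos p
          existsPos (inj₁ b) = ¬blocking b
          existsPos (inj₂ eq′) = π≢∀ (≡.trans (sym eq) eq′)

          loses : ∀ {q} → Move p q → pol e ≡ π → ¬ R (normPos q)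
          loses (explore {t = t} t∈ pt s _) _ _ = ¬blocking (t , t∈ , (λ { refl → 𝟙↛ s }) , inj₁ pt)
          loses (fork {t = t} t∈ pt _) _ _ = ¬blocking (t , t∈ , (λ { refl → case-∃≡∀ pt }) , inj₂ pt)
            where
            case-∃≡∀ : ∃ₚ {n} ≢ ∀ₚ
            case-∃≡∀ ()
          loses (alea (alea pe _ _)) _ _ = existsPos (inj₂ pe)
          loses (choose _ pe s) eq r with ≡.trans (sym pe) eq
          ... | refl = ¬adv (lose (succs-complete s) r)
          loses (junk _ pe a∈ s) eq r with ≡.trans (sym pe) eq
          ... | refl = ¬adv (inj₁ (a∈ , lose (succs-complete s) r))
          loses (fill {Y = Y} {e′ = e′} {t = t} {a = a} _ pe t∈ pt s s′ rep) eq r with ≡.trans (sym pe) eq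
          ... | refl = ¬adv (inj₂ (lose (⊆norm (X⊆U t∈) t∈) (pt , lose (succs-complete s′) (lose (succs-complete s)
                (subst (λ Y → R ⟨ Γ ∪ˢ ⁅ a ⁆ ∣ Y ⊢ e′ ⟩) (norm-updates X⊆U (replace⇒updates rep)) r)))))

          turn : (∃ λ q → Move p q × S (q ∷ p ∷ h)) → ∃ λ q → Move p q × Play q (p ∷ h) × ¬ R (normPos q)
          turn (q , m , s) = q , m , move pl m s , loses m eq

        aim : ∀ π → pol e ≡ π → ¬ Advance R (normPos p) π → Escape (p , h , pl , ¬r)
        aim ∀ₚ eq ¬adv =
          let (e′ , e′∈ , ¬re′) = find (¬All⇒Any¬ (λ e′ → proj₂ (ν-iter (suc j)) _) (succs e) ¬adv)
              al = alea eq (λ t t∈ qt → inert t t∈ qt) (succs-sound e e′∈)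
              m = alea al
          in (λ w → proj₂ w _ al) ,
             _ , m , move pl m (spoiler (play⇒S pl) (inj₂ eq) m) , ¬re′
          where
          inert : ∀ t → t ∈ X → Quant (pol t) → t ≡ 𝟙
          inert t t∈ qt with t ≟ 𝟙
          ... | yes eq = eq
          ... | no neq = contradiction (t , t∈ , neq , qt) ¬blocking
        aim ∃ₚ eq ¬adv = duplicates ∃ₚ eq (λ ()) ¬adv
        aim (?ₚ a) eq ¬adv = duplicates (?ₚ a) eq (λ ()) ¬adv

    next : Trapped → Trapped
    next s = let (_ , q , _ , pl , ¬r) = escape s in q , _ , pl , ¬r

    run : Trapped → ℕ → Trapped
    run s zero = s
    run s (suc i) = next (run s i)

    run-histories : ∀ s i → histories (λ i → proj₁ (run s i)) (proj₁ (proj₂ s)) i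
                            ≡ proj₁ (run s i) ∷ proj₁ (proj₂ (run s i))
    run-histories s zero = refl
    run-histories s (suc i) = cong (proj₁ (run s (suc i)) ∷_) (run-histories s i)

    untrapped : ¬ Trapped
    untrapped s@(p , h , pl , ¬r) = no-losing-continuation pl (λ i → proj₁ (run s i)) refl
      (λ i → proj₁ (proj₂ (proj₂ (escape (run s i)))))
      (λ i → subst S (sym (run-histories s i)) (play⇒S (proj₁ (proj₂ (proj₂ (run s i))))))
      0 (λ i _ → proj₁ (escape (run s i)))

  -- Stage `j`, once known for all plays, is the `safe` hypothesis that rules out traps at stage
  -- `suc j`.
  play⇒ν : ∀ j {p h} → Play p h → proj₁ (ν-iter j) (normPos p)
  play⇒ν zero _ = tt
  play⇒ν (suc j) {p} {h} pl with proj₂ (ν-iter (suc j)) (normPos p)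
  ... | yes r = r
  ... | no ¬r = contradiction (p , h , pl , ¬r) (untrapped j (play⇒ν j))

  start∈W : W (normPos p₀)
  start∈W = play⇒ν (proj₁ ν-stable) initial

-- Derivations from winning positions

-- Innermost context first.
plug : List (Expr n) → Expr n → Expr n
plug [] u = u
plug (g ∷ gs) u = plug gs (g ⋆ u)

plug-mono : ∀ gs {u v : Expr n} → u ≤ v → plug gs u ≤ plug gs v
plug-mono [] h = h
plug-mono (g ∷ gs) h = plug-mono gs (⋆-mono refl h)

plug-⋆ : ∀ gs {u v : Expr n} → plug gs u ⋆ v ≤ plug gs (u ⋆ v)
plug-⋆ [] = refl
plug-⋆ (g ∷ gs) = trans (plug-⋆ gs) (plug-mono gs assoc-≥)

pol-plug : ∀ gs (u : Expr n) → pol (plug gs u) ≡ pol u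
pol-plug [] u = refl
pol-plug (g ∷ gs) u = pol-plug gs (g ⋆ u)

plug-step : ∀ gs {u v : Expr n} → u ⟶ v → plug gs u ⟶ plug gs v
plug-step [] s = s
plug-step (g ∷ gs) s = plug-step gs (⋆-ctx s)

-- Only `⋆-𝟙` can remove a context, and it needs `𝟙` in the hole.
plug-step⁻ : ∀ gs {u y : Expr n} → u ≢ 𝟙 → plug gs u ⟶ y → ∃ λ v → u ⟶ v × y ≡ plug gs v
plug-step⁻ [] _ s = _ , s , refl
plug-step⁻ (g ∷ gs) u≢𝟙 s with plug-step⁻ gs (λ ()) s
... | _ , ⋆-𝟙 , _ = contradiction refl u≢𝟙
... | _ , ⋆-ctx s′ , eq = _ , s′ , eq

-- A context g multiplies the size of what it surrounds, so that the parts of u₁ ⊓ u₂ together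
-- weigh less than u₁ ⊓ u₂ in every context although the context is duplicated.
size : Expr n → ℕ
size (lit a) = 3
size 𝟘 = 1
size ⊤ᵉ = 1
size 𝟙 = 1
size (e ⊔ f) = suc (size e + size f)
size (e ⊓ f) = suc (size e + size f)
size (g ⋆ e) = suc (size e * suc (size g))
size (e ◇) = suc (suc (size e))

∈-─ : {A : Set} {xs : List A} {x y : A} (x∈ : x ∈ xs) → y ∈ xs → y ≡ x ⊎ y ∈ (xs ─ x∈)
∈-─ (here refl) (here refl) = inj₁ refl
∈-─ (here refl) (there y∈) = inj₂ y∈
∈-─ (there x∈) (here refl) = inj₂ (here refl)
∈-─ (there x∈) (there y∈) = [ inj₁ , inj₂ ∘ there ]′ (∈-─ x∈ y∈)

sum-─ : {A : Set} (f : A → ℕ) {xs : List A} {x : A} (x∈ : x ∈ xs) →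
        sum (map f xs) ≡ f x + sum (map f (xs ─ x∈))
sum-─ f (here refl) = refl
sum-─ f {y ∷ xs} {x} (there x∈) = ≡.trans (cong (f y +_) (sum-─ f x∈))
  (≡.trans (sym (ℕₚ.+-assoc (f y) (f x) _)) (≡.trans (cong (_+ sum (map f (xs ─ x∈))) (ℕₚ.+-comm (f y) (f x)))
    (ℕₚ.+-assoc (f x) (f y) _)))

module Derivation {n : ℕ} (U V : List (Expr n)) (U-closed : Closed U) (V-closed : Closed V)
                  (letters∈U : ∀ a → ⊤ᵉ ⋆ lit a ∈ U) where

  open Arena U V

  Below : Expr n → List (Expr n) → Set
  Below v D = ∀ {y} → y ∈ D → v ≤ y

  -- The context D records the letters of Γ as the expressions ⊤ᵉ ⋆ lit a.
  Within : List (Expr n) → Pos n → Set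
  Within D p = X p ⊆ D × (∀ a → a ∈ˢ Γ p → ⊤ᵉ ⋆ lit a ∈ D)

  Good : List (Expr n) → Pos n → Set
  Good D p = Normal p × W p × Within D p

  -- Any lower bound `v` is allowed, not only `⋂ D`: after a FILL or inside a loop the value carries
  -- more information than `D` records.
  Claim : List (Expr n) → Set
  Claim D = ∀ {v p} → Below v D → Good D p → v ≤ goal p

  within-mono : ∀ {D D′ p} → D ⊆ D′ → Within D p → Within D′ p
  within-mono D⊆ (X⊆ , Γ⊆) = D⊆ ∘ X⊆ , λ a a∈ → D⊆ (Γ⊆ a a∈)

  -- Decidability turns the relevant goals into a list, and so their meet `ω` into an expression
  -- that a loop invariant may contain.
  good? : ∀ D → Decidable (Good D)
  good? D p = normal? p ×-dec (proj₂ winning p ×-dec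
    (map′ (λ all → All.lookup all) (λ X⊆ → All.tabulate X⊆) (all? (_∈? D) (X p))
     ×-dec Finₚ.all? (λ a → (a ∈ˢ? Γ p) →-dec (⊤ᵉ ⋆ lit a ∈? D))))

  module Context (D : List (Expr n)) (D⊆U : D ⊆ U)
                 (ih : ∀ {D′ s} → D′ ⊆ U → D ⊆ D′ → s ∈ D′ → s ∉ D → Claim D′) where

    goals : List (Expr n)
    goals = map goal (filter (good? D) positions)

    ω : Expr n
    ω = ⋂ goals

    ω≤goal : ∀ {p} → Good D p → ω ≤ goal p
    ω≤goal g = ⋂-lower (∈-map⁺ goal (∈-filter⁺ (good? D) (∈-positions (proj₁ g)) g))

    ≤ω : ∀ {v} → (∀ {p} → Good D p → v ≤ goal p) → v ≤ ω
    ≤ω {v} h = ⋂-greatest goals go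
      where
      go : ∀ {x} → x ∈ goals → v ≤ x
      go x∈ with ∈-map⁻ goal x∈
      ... | p , p∈ , refl = h (proj₂ (∈-filter⁻ (good? D) {xs = positions} p∈))

    -- An item (st , u) is the element of D obtained by plugging u into the contexts of st,
    -- together with a value below it; ret replaces the unfolded loop gs[c ◇] by its invariant b.
    data Stack : Set where
      bot : Stack
      ret : (gs : List (Expr n)) (b : Expr n) → b ≤ ω → b ≤ plug gs 𝟙 → Stack
      _▹_ : Stack → Expr n → Stack

    Item : Set
    Item = Stack × Expr n

    frames : Stack → List (Expr n)
    frames bot = []
    frames (ret gs _ _ _) = gs
    frames (st ▹ g) = g ∷ frames st

    head : Stack → Expr n
    head bot = 𝟙
    head (ret _ b _ _) = b
    head (st ▹ g) = head st ⋆ g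

    elem : Item → Expr n
    elem (st , u) = plug (frames st) u

    val : Item → Expr n
    val (st , u) = head st ⋆ u

    val≤elem : ∀ st u → val (st , u) ≤ elem (st , u)
    val≤elem bot u = unitˡ-≤
    val≤elem (ret gs b _ b≤) u = trans (⋆-mono b≤ refl) (trans (plug-⋆ gs) (plug-mono gs unitˡ-≤))
    val≤elem (st ▹ g) u = trans assoc-≥ (val≤elem st (g ⋆ u))

    -- A `ret` weighs 1 whatever `gs` is: the body of a loop is explored only until it returns to
    -- `b`, so the contexts in `gs` are never entered from there. Unfolding `c ◇` thus exchanges its
    -- load for `size c` alone, as `enter-<` states.
    weight : Stack → ℕ
    weight bot = 1
    weight (ret _ _ _ _) = 1
    weight (st ▹ g) = suc (size g) * weight st

    wt : Item → ℕ
    wt (st , u) = size u * weight st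

    load : List Item → ℕ
    load I = sum (map wt I)

    weight-pos : ∀ st → 0 <ℕ weight st
    weight-pos bot = s≤s z≤n
    weight-pos (ret _ _ _ _) = s≤s z≤n
    weight-pos (st ▹ g) = ℕₚ.<-≤-trans (weight-pos st) (ℕₚ.m≤m+n (weight st) (size g * weight st))

    wt-mono-< : ∀ st m k → m <ℕ k → m * weight st <ℕ k * weight st
    wt-mono-< st m k m<k = ℕₚ.*-monoˡ-< (weight st) {{>-nonZero (weight-pos st)}} m<k

    single : ∀ i j → wt j <ℕ wt i → load (j ∷ []) <ℕ wt i
    single i j = subst (_<ℕ wt i) (sym (ℕₚ.+-identityʳ (wt j)))

    pair-< : ∀ st u₁ u₂ k → size u₁ + size u₂ <ℕ k → load ((st , u₁) ∷ (st , u₂) ∷ []) <ℕ k * weight st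
    pair-< st u₁ u₂ k h = subst (_<ℕ k * weight st)
      (≡.trans (ℕₚ.*-distribʳ-+ (weight st) (size u₁) (size u₂))
        (cong (size u₁ * weight st +_) (sym (ℕₚ.+-identityʳ _))))
      (wt-mono-< st (size u₁ + size u₂) k h)

    pop-< : ∀ st g → wt (st , g) <ℕ wt (st ▹ g , 𝟙)
    pop-< st g = subst (wt (st , g) <ℕ_) (sym (ℕₚ.*-identityˡ _))
      (wt-mono-< st (size g) (suc (size g)) (ℕₚ.n<1+n (size g)))

    focus-< : ∀ st g u → wt (st ▹ g , u) <ℕ wt (st , g ⋆ u)
    focus-< st g u = subst (_<ℕ wt (st , g ⋆ u)) (ℕₚ.*-assoc (size u) (suc (size g)) (weight st))
      (wt-mono-< st (size u * suc (size g)) (size (g ⋆ u)) (ℕₚ.n<1+n _))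

    enter-< : ∀ st c → size c * 1 <ℕ wt (st , c ◇)
    enter-< st c = subst (_<ℕ wt (st , c ◇)) (sym (ℕₚ.*-identityʳ (size c)))
      (ℕₚ.<-≤-trans (s≤s (ℕₚ.n≤1+n (size c)))
        (ℕₚ.m≤m*n (size (c ◇)) (weight st) {{>-nonZero (weight-pos st)}}))

    data LeftMove (t : Expr n) : List (Expr n) → Set where
      ∃-move : ∀ {t′} → pol t ≡ ∃ₚ → t ⟶ t′ → LeftMove t (t′ ∷ [])
      ∀-move : ∀ {ts} → pol t ≡ ∀ₚ → (∀ {y} → t ⟶ y → y ∈ ts) → (∀ {y} → y ∈ ts → t ⟶ y) → LeftMove t ts

    -- A settled item fixes what Spoiler will do with it, in terms of items already in `L`;
    -- `explore⇒≤` replays these choices. `resolve` never settles a `𝟙` on top of `ret`, because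
    -- there `b ≤ ω` ends the argument.
    data Settled (L : List Item) : Item → Set where
      inert   : Settled L (bot , 𝟙)
      refocus : ∀ {st g u} → (st ▹ g , u) ∈ L → Settled L (st , g ⋆ u)
      filled  : ∀ {st a} → (st , 𝟙) ∈ L → Settled L (st , lit a)
      moved   : ∀ {i} J → J ⊆ L → LeftMove (elem i) (map elem J) → load J <ℕ wt i → Settled L i

    settled-mono : ∀ {L L′ i} → L ⊆ L′ → Settled L i → Settled L′ i
    settled-mono L⊆ inert = inert
    settled-mono L⊆ (refocus j∈) = refocus (L⊆ j∈)
    settled-mono L⊆ (filled j∈) = filled (L⊆ j∈)
    settled-mono L⊆ (moved J J⊆ m lt) = moved J (L⊆ ∘ J⊆) m lt

    Letter : Set
    Letter = Stack × Fin n

    -- T lists the items still to be explored, A the items st[a] that wait for a FILL move.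
    data Status (L T : List Item) (A : List Letter) : Item → Set where
      settled : ∀ {i} → Settled L i → Status L T A i
      todo    : ∀ {i} → i ∈ T → Status L T A i
      letter  : ∀ {st a} → (st , a) ∈ A → Status L T A (st , lit a)

    -- The invariant of the exploration: `L` only grows and `v` only shrinks. `roots` ensures that
    -- every `X ⊆ D` can be represented by items of `L`.
    record Known (v : Expr n) (L T : List Item) (A : List Letter) : Set where
      field
        below  : Below v D
        values : ∀ {i} → i ∈ L → v ≤ val i
        elems  : ∀ {i} → i ∈ L → elem i ∈ D
        roots  : ∀ {y} → y ∈ D → (bot , y) ∈ L
        todos  : T ⊆ L
        status : ∀ {i} → i ∈ L → Status L T A i

    -- The extra unit pays for waking a letter, which turns it into the item `(st , 𝟙)` to be
    -- explored.
    letterLoad : List Letter → ℕ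
    letterLoad A = sum (map (λ (st , a) → suc (wt (st , 𝟙))) A)

    total : List Item → List Letter → ℕ
    total T A = load T + letterLoad A

    -- Several items may represent one expression, and a move removes that expression from a set, so
    -- all of them have to go.
    _∖ᵢ_ : List Item → Expr n → List Item
    I ∖ᵢ t = filter (λ i → ¬? (elem i ≟ t)) I

    load-∖ᵢ-≤ : ∀ I t → load (I ∖ᵢ t) ≤ℕ load I
    load-∖ᵢ-≤ [] t = z≤n
    load-∖ᵢ-≤ (i ∷ I) t with elem i ≟ t
    ... | yes _ = ℕₚ.≤-trans (load-∖ᵢ-≤ I t) (ℕₚ.m≤n+m (load I) (wt i))
    ... | no _ = ℕₚ.+-monoʳ-≤ (wt i) (load-∖ᵢ-≤ I t)

    load-∖ᵢ : ∀ {I i t} → i ∈ I → elem i ≡ t → wt i + load (I ∖ᵢ t) ≤ℕ load I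
    load-∖ᵢ {i ∷ I} {t = t} (here refl) eq with elem i ≟ t
    ... | yes _ = ℕₚ.+-monoʳ-≤ (wt i) (load-∖ᵢ-≤ I t)
    ... | no neq = contradiction eq neq
    load-∖ᵢ {j ∷ I} {i} {t} (there i∈) eq with elem j ≟ t
    ... | yes _ = ℕₚ.≤-trans (load-∖ᵢ i∈ eq) (ℕₚ.m≤n+m (load I) (wt j))
    ... | no _ = subst (_≤ℕ wt j + load I)
      (≡.trans (sym (ℕₚ.+-assoc (wt j) (wt i) _))
        (≡.trans (cong (_+ load (I ∖ᵢ t)) (ℕₚ.+-comm (wt j) (wt i))) (ℕₚ.+-assoc (wt i) (wt j) _)))
      (ℕₚ.+-monoʳ-≤ (wt j) (load-∖ᵢ i∈ eq))

    load-++ : ∀ J I → load (J ++ I) ≡ load J + load I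
    load-++ J I = ≡.trans (cong sum (map-++ wt J I)) (sum-++ (map wt J) (map wt I))

    load-replace : ∀ {I i} J → i ∈ I → load J <ℕ wt i → load (J ++ I ∖ᵢ elem i) <ℕ load I
    load-replace {I} {i} J i∈ lt = subst (_<ℕ load I) (sym (load-++ J (I ∖ᵢ elem i)))
      (ℕₚ.<-≤-trans (ℕₚ.+-monoˡ-< (load (I ∖ᵢ elem i)) lt) (load-∖ᵢ i∈ refl))

    Lists : List (Expr n) → List Item → Set
    Lists X I = X ⊆ map elem I × map elem I ⊆ X

    lists-replace : ∀ {X I t ts J} → ts ⊆ U → Lists X I → map elem I ⊆ U → Lists ts J →
                    Lists (X [ t ≔ ts ]) (J ++ I ∖ᵢ t)
    lists-replace {X} {I} {t} {ts} {J} ts⊆U (X⊆ , ⊆X) I⊆U (ts⊆ , ⊆ts) = to , from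
      where
      to : X [ t ≔ ts ] ⊆ map elem (J ++ I ∖ᵢ t)
      to y∈ with ∈-++⁻ ts (norm⊆ y∈)
      ... | inj₁ y∈ts with ∈-map⁻ elem (ts⊆ y∈ts)
      ...   | j , j∈ , refl = ∈-map⁺ elem (∈-++⁺ˡ j∈)
      to y∈ | inj₂ y∈X with ∈-∖⁻ {X = X} y∈X
      ... | y∈′ , y≢ with ∈-map⁻ elem (X⊆ y∈′)
      ...   | i , i∈ , refl = ∈-map⁺ elem (∈-++⁺ʳ J (∈-filter⁺ (λ i → ¬? (elem i ≟ t)) i∈ y≢))

      from : map elem (J ++ I ∖ᵢ t) ⊆ X [ t ≔ ts ]
      from y∈ with ∈-map⁻ elem y∈
      ... | i , i∈ , refl with ∈-++⁻ J i∈
      ...   | inj₁ i∈J = let y∈ts = ⊆ts (∈-map⁺ elem i∈J) in ⊆norm (ts⊆U y∈ts) (∈-++⁺ˡ y∈ts)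
      ...   | inj₂ i∈I with ∈-filter⁻ (λ i → ¬? (elem i ≟ t)) {xs = I} i∈I
      ...     | i∈′ , y≢ = ⊆norm (I⊆U (∈-map⁺ elem i∈′))
        (∈-++⁺ʳ ts (∈-∖⁺ (⊆X (∈-map⁺ elem i∈′)) y≢))

    -- Lexicographic induction on the load of the items representing X, which decreases along
    -- Spoiler's exploration, and on the rank, which decreases along right-hand moves.
    module Explore {v L A} (known : Known v L [] A)
                   (solved : ∀ {v′ L′ T′ A′} → total T′ A′ <ℕ total [] A → Known v′ L′ T′ A′ → v′ ≤ ω) where

      open Known known

      data Pending (i : Item) : Set where
        focusing : ∀ {st g u} → i ≡ (st , g ⋆ u) → (st ▹ g , u) ∈ L → Pending i
        moving   : ∀ J → J ⊆ L → LeftMove (elem i) (map elem J) → load J <ℕ wt i → Pending i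

      data Idle (i : Item) : Set where
        unit : elem i ≡ 𝟙 → Idle i
        lit  : ∀ {st a} → i ≡ (st , lit a) → (st , 𝟙) ∈ L ⊎ (st , a) ∈ A → Idle i

      pending⊎idle : ∀ {i} → i ∈ L → Pending i ⊎ Idle i
      pending⊎idle i∈ with status i∈
      ... | settled inert = inj₂ (unit refl)
      ... | settled (refocus j∈) = inj₁ (focusing refl j∈)
      ... | settled (filled j∈) = inj₂ (lit refl (inj₁ j∈))
      ... | settled (moved J J⊆ m lt) = inj₁ (moving J J⊆ m lt)
      ... | letter a∈ = inj₂ (lit refl (inj₂ a∈))

      classify : ∀ I → I ⊆ L → (∃ λ i → i ∈ I × Pending i) ⊎ (∀ {i} → i ∈ I → Idle i)
      classify [] I⊆ = inj₂ λ ()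
      classify (i ∷ I) I⊆ with pending⊎idle (I⊆ (here refl)) | classify I (I⊆ ∘ there)
      ... | inj₁ p | _ = inj₁ (i , here refl , p)
      ... | inj₂ _ | inj₁ (j , j∈ , p) = inj₁ (j , there j∈ , p)
      ... | inj₂ d | inj₂ ds = inj₂ λ { (here refl) → d ; (there i∈) → ds i∈ }

      idle⇒nonblocking : ∀ {i} → Idle i → elem i ≢ 𝟙 → ¬ Quant (pol (elem i))
      idle⇒nonblocking (unit eq) neq _ = neq eq
      idle⇒nonblocking (lit {st} {a} refl _) _ q with pol (plug (frames st) (lit a)) | pol-plug (frames st) (lit a)
      idle⇒nonblocking (lit refl _) _ (inj₁ ()) | _ | refl
      idle⇒nonblocking (lit refl _) _ (inj₂ ()) | _ | refl

      ∈L⇒∈U : ∀ {I} → I ⊆ L → map elem I ⊆ U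
      ∈L⇒∈U I⊆ y∈ with ∈-map⁻ elem y∈
      ... | i , i∈ , refl = D⊆U (elems (I⊆ i∈))

      replace⊆L : ∀ {I J t} → I ⊆ L → J ⊆ L → (J ++ I ∖ᵢ t) ⊆ L
      replace⊆L {I} {J} {t} I⊆ J⊆ i∈ =
        [ J⊆ , I⊆ ∘ proj₁ ∘ ∈-filter⁻ (λ i → ¬? (elem i ≟ t)) {xs = I} ]′ (∈-++⁻ J i∈)

      LettersIn : Subset n → Set
      LettersIn Γ = ∀ a → a ∈ˢ Γ → ⊤ᵉ ⋆ lit a ∈ D

      normal-update : ∀ {X t ts} → norm X ≡ X → ts ⊆ U → norm (X [ t ≔ ts ]) ≡ X [ t ≔ ts ]
      normal-update {X} {t} {ts} eq ts⊆U = norm-idem (ts ++ X ∖ t)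
        (λ y∈ → [ ts⊆U , (λ y∈′ → norm⊆U (subst (_ ∈_) (sym eq) (proj₁ (∈-∖⁻ {X = X} y∈′)))) ]′ (∈-++⁻ ts y∈))

      -- `explored` and `advanced` are the two recursion hypotheses of the lexicographic order: the
      -- first permits any rank for a smaller load, the second keeps the items and lowers the rank.
      module Body {I Γ X e} k (nf : Normal ⟨ Γ ∣ X ⊢ e ⟩) (step : Step W (Rank winning k) ⟨ Γ ∣ X ⊢ e ⟩)
                  (I⊆ : I ⊆ L) (lists : Lists X I) (Γ⊆ : LettersIn Γ)
                  (explored : ∀ {I′ Γ′ X′ e′} → load I′ <ℕ load I → ∀ k′ → Rank winning k′ ⟨ Γ′ ∣ X′ ⊢ e′ ⟩ →
                              I′ ⊆ L → Lists X′ I′ → LettersIn Γ′ → v ≤ e′)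
                  (advanced : ∀ {e′} → Rank winning k ⟨ Γ ∣ X ⊢ e′ ⟩ → v ≤ e′) where

        X⊆ = proj₁ lists
        ⊆X = proj₂ lists
        left = proj₁ step
        right = proj₂ step

        module Filling {st a e′} (i∈ : (st , lit a) ∈ I) (next : (st , 𝟙) ∈ L ⊎ (st , a) ∈ A)
                       (s′ : e ⟶ e′) (pe : pol e ≡ ?ₚ a)
                       (r′ : Rank winning k
                               ⟨ Γ ∪ˢ ⁅ a ⁆ ∣ X [ elem (st , lit a) ≔ elem (st , 𝟙) ∷ [] ] ⊢ e′ ⟩) where

          i : Item
          i = st , lit a

          t′∈U : elem (st , 𝟙) ∈ U
          t′∈U = U-closed (D⊆U (elems (I⊆ i∈))) (plug-step (frames st) lit)

          v≤filled : v ≤ head st ⋆ lit a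
          v≤filled = values (I⊆ i∈)

          lists′ : Lists (X [ elem i ≔ elem (st , 𝟙) ∷ [] ]) ((st , 𝟙) ∷ I ∖ᵢ elem i)
          lists′ = lists-replace {J = (st , 𝟙) ∷ []} (λ { (here refl) → t′∈U }) lists (∈L⇒∈U I⊆) (id , id)

          lettersIn′ : ∀ {D′} → D ⊆ D′ → ⊤ᵉ ⋆ lit a ∈ D′ → ∀ c → c ∈ˢ Γ ∪ˢ ⁅ a ⁆ → ⊤ᵉ ⋆ lit c ∈ D′
          lettersIn′ D⊆ a∈ c c∈ with x∈p∪q⁻ Γ ⁅ a ⁆ c∈
          ... | inj₁ c∈Γ = D⊆ (Γ⊆ c c∈Γ)
          ... | inj₂ c∈a with x∈⁅y⁆⇒x≡y a c∈a
          ...   | refl = a∈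

          within′ : ∀ {D′} → D ⊆ D′ → ⊤ᵉ ⋆ lit a ∈ D′ → elem (st , 𝟙) ∈ D′ →
                    Within D′ ⟨ Γ ∪ˢ ⁅ a ⁆ ∣ X [ elem i ≔ elem (st , 𝟙) ∷ [] ] ⊢ e′ ⟩
          within′ {D′} D⊆ a∈ t′∈ = (λ y∈ → X′⊆ (proj₁ lists′ y∈)) , lettersIn′ D⊆ a∈
            where
            X′⊆ : map elem ((st , 𝟙) ∷ I ∖ᵢ elem i) ⊆ D′
            X′⊆ (here refl) = t′∈
            X′⊆ (there y∈) with ∈-map⁻ elem y∈
            ... | j , j∈ , refl = D⊆ (elems (I⊆ (proj₁ (∈-filter⁻ (λ i → ¬? (elem i ≟ _)) {xs = I} j∈))))

          good′ : ∀ {D′} → D ⊆ D′ → ⊤ᵉ ⋆ lit a ∈ D′ → elem (st , 𝟙) ∈ D′ → Good D′ _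
          good′ D⊆ a∈ t′∈ =
            (normal-update (proj₁ nf) (λ { (here refl) → t′∈U }) , V-closed (proj₂ nf) s′) ,
            rank⇒W k r′ , within′ D⊆ a∈ t′∈

          -- `⋆-⊓-left` carries the bound `x` to the left of the letter, where it joins `head st`.
          by-fill : ∀ {x} → v ≤ x → head st ⊓ x ≤ e′ → v ≤ e
          by-fill v≤x h = trans (⊓-glb v≤filled v≤x) (trans ⋆-⊓-left (trans (⋆-mono h refl) (step-? s′ pe)))

          -- The position after the FILL needs both expressions in its context, so both are added;
          -- one of them being new suffices for the outer induction.
          extended : ⊤ᵉ ⋆ lit a ∉ D ⊎ elem (st , 𝟙) ∉ D → v ≤ e
          extended new = by-fill (⊓-glb refl (trans v≤filled (⋆-mono ≤⊤ refl)))
            ([ ih D′⊆U (there ∘ there) (there (here refl)) , ih D′⊆U (there ∘ there) (here refl) ]′ new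
              below′ (good′ (there ∘ there) (there (here refl)) (here refl)))
            where
            D′⊆U : (elem (st , 𝟙) ∷ ⊤ᵉ ⋆ lit a ∷ D) ⊆ U
            D′⊆U (here refl) = t′∈U
            D′⊆U (there (here refl)) = letters∈U a
            D′⊆U (there (there y∈)) = D⊆U y∈

            below′ : Below (head st ⊓ (v ⊓ (⊤ᵉ ⋆ lit a))) (elem (st , 𝟙) ∷ ⊤ᵉ ⋆ lit a ∷ D)
            below′ (here refl) = trans ⊓-l (trans unitʳ-≥ (val≤elem st 𝟙))
            below′ (there (here refl)) = trans ⊓-r ⊓-r
            below′ (there (there y∈)) = trans ⊓-r (trans ⊓-l (below y∈))

          conclude-from : Dec (⊤ᵉ ⋆ lit a ∈ D) → Dec (elem (st , 𝟙) ∈ D) → v ≤ e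
          conclude-from (no a∉) _ = extended (inj₁ a∉)
          conclude-from _ (no t′∉) = extended (inj₂ t′∉)
          conclude-from (yes a∈) (yes t′∈) = [ on-settled , on-letter ]′ next
            where
            -- Here (st , 𝟙) keeps its value in v, so the step on the right is justified like JUNK.
            on-settled : (st , 𝟙) ∈ L → v ≤ e
            on-settled j∈ = trans
              (junk-sound
                (explored (load-replace ((st , 𝟙) ∷ []) i∈
                    (single (st , lit a) (st , 𝟙) (wt-mono-< st 1 3 (s≤s (s≤s z≤n)))))
                  k r′ (replace⊆L {J = _ ∷ []} I⊆ (λ { (here refl) → j∈ })) lists′ (lettersIn′ id a∈))
                (trans v≤filled (⋆-mono ≤⊤ refl)))
              (step-? s′ pe)

            -- First FILL of this item: the value becomes `head st ⊓ v`, for which `(st , 𝟙)` still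
            -- has to be explored. The recursion therefore aims at `ω`, which lies below the new
            -- goal because the position reached is again good for the same `D`.
            on-letter : (st , a) ∈ A → v ≤ e
            on-letter a∈A = by-fill refl (trans (solved decreases known′) (ω≤goal (good′ id a∈ t′∈)))
              where
              decreases : total ((st , 𝟙) ∷ []) (A ─ a∈A) <ℕ total [] A
              decreases = subst (total ((st , 𝟙) ∷ []) (A ─ a∈A) <ℕ_)
                (sym (sum-─ (λ (st , a) → suc (wt (st , 𝟙))) a∈A))
                (ℕₚ.+-monoˡ-< (letterLoad (A ─ a∈A)) (s≤s (ℕₚ.≤-reflexive (ℕₚ.+-identityʳ (wt (st , 𝟙))))))

              status′ : ∀ {j} → j ∈ (st , 𝟙) ∷ L → Status ((st , 𝟙) ∷ L) ((st , 𝟙) ∷ []) (A ─ a∈A) j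
              status′ (here refl) = todo (here refl)
              status′ (there j∈) with status j∈
              ... | settled σ = settled (settled-mono there σ)
              ... | letter b∈ with ∈-─ a∈A b∈
              ...   | inj₁ refl = settled (filled (here refl))
              ...   | inj₂ b∈′ = letter b∈′

              known′ : Known (head st ⊓ v) ((st , 𝟙) ∷ L) ((st , 𝟙) ∷ []) (A ─ a∈A)
              known′ = record
                { below = trans ⊓-r ∘ below
                ; values = λ { (here refl) → trans ⊓-l unitʳ-≥ ; (there j∈) → trans ⊓-r (values j∈) }
                ; elems = λ { (here refl) → t′∈ ; (there j∈) → elems j∈ }
                ; roots = there ∘ roots
                ; todos = λ { (here refl) → here refl }
                ; status = status′
                }

          conclude : v ≤ e
          conclude = conclude-from (_ ∈? D) (_ ∈? D)

        fill-in : ∀ {t t′ e′ a} → t ∈ X → pol t ≡ ?ₚ a → t ⟶ t′ → e ⟶ e′ → pol e ≡ ?ₚ a →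
                  Rank winning k ⟨ Γ ∪ˢ ⁅ a ⁆ ∣ X [ t ≔ t′ ∷ [] ] ⊢ e′ ⟩ →
                  (∀ {i} → i ∈ I → Idle i) → v ≤ e
        fill-in t∈ pt s s′ pe r′ idle with ∈-map⁻ elem (X⊆ t∈)
        ... | i , i∈ , refl with idle i∈
        ...   | unit eq = contradiction (subst (_⟶ _) eq s) 𝟙↛
        ...   | lit {st} {b} refl next with ≡.trans (sym pt) (pol-plug (frames st) (lit b))
                                          | plug-step⁻ (frames st) (λ ()) s
        ...     | refl | _ , lit , refl = Filling.conclude i∈ next s′ pe r′

        finish : ∀ π → pol e ≡ π → Advance (Rank winning k) ⟨ Γ ∣ X ⊢ e ⟩ π → (∀ {i} → i ∈ I → Idle i) → v ≤ e
        finish ∀ₚ eq adv idle = step-∀ e eq (λ s →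
          advanced (All.lookup adv (succs-complete s)))
        finish ∃ₚ eq adv idle =
          let (e′ , e′∈ , r′) = find adv
          in trans (advanced r′) (step-∃ (succs-sound e e′∈) eq)
        finish (?ₚ a) eq (inj₁ (a∈ , adv)) idle =
          let (e′ , e′∈ , r′) = find adv
          in trans (junk-sound (advanced r′) (below (Γ⊆ a a∈)))
               (step-? (succs-sound e e′∈) eq)
        finish (?ₚ a) eq (inj₂ adv) idle =
          let (t , t∈ , pt , adv′) = find adv
              (t′ , t′∈ , adv″) = find adv′
              (e′ , e′∈ , r′) = find adv″
          in fill-in t∈ pt (succs-sound t t′∈) (succs-sound e e′∈) eq r′ idle

        after-move : ∀ {i J ts} → i ∈ I → J ⊆ L → load J <ℕ wt i → ts ⊆ U → Lists ts J →
                     W ⟨ Γ ∣ X [ elem i ≔ ts ] ⊢ e ⟩ → v ≤ e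
        after-move {i} {J} i∈ J⊆ lt ts⊆U ts-lists w =
          -- After a left move only membership in `W` is left, so a new rank is drawn; the smaller
          -- load permits this.
          let (k′ , r′) = W-rank (normal-update (proj₁ nf) ts⊆U , proj₂ nf) w
          in explored (load-replace J i∈ lt) k′ r′ (replace⊆L I⊆ J⊆)
               (lists-replace ts⊆U lists (∈L⇒∈U I⊆) ts-lists) Γ⊆

        advance-left : ∀ {i J} → i ∈ I → J ⊆ L → load J <ℕ wt i → LeftMove (elem i) (map elem J) → v ≤ e
        advance-left {i} {J} i∈ J⊆ lt m with map elem J in eqJ | m
        ... | t′ ∷ [] | ∃-move pt s =
          let i∈X = ⊆X (∈-map⁺ elem i∈)
              b = elem i , i∈X , (λ eq → 𝟙↛ (subst (_⟶ t′) eq s)) , inj₁ pt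
          in after-move i∈ J⊆ lt (λ y∈ → ∈L⇒∈U J⊆ (subst (_ ∈_) (sym eqJ) y∈))
               (subst (_ ∈_) (sym eqJ) , subst (_ ∈_) eqJ)
               (All.lookup (subst (Respond W _ (elem i)) pt (All.lookup (left b) i∈X)) (succs-complete s))
        ... | ts | ∀-move pt complete sound =
          let i∈X = ⊆X (∈-map⁺ elem i∈)
              b = elem i , i∈X , (λ eq → contradiction (≡.trans (sym (cong pol eq)) pt) λ ()) , inj₂ pt
          in after-move i∈ J⊆ lt (U-closed (norm⊆U (subst (elem i ∈_) (sym (proj₁ nf)) i∈X)) ∘ succs-sound (elem i))
               ((λ y∈ → subst (_ ∈_) (sym eqJ) (complete (succs-sound (elem i) y∈))) ,
                (λ y∈ → succs-complete (sound (subst (_ ∈_) eqJ y∈))))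
               (subst (Respond W _ (elem i)) pt (All.lookup (left b) i∈X))

        go : (∃ λ i → i ∈ I × Pending i) ⊎ (∀ {i} → i ∈ I → Idle i) → v ≤ e
        go (inj₁ (i , i∈ , moving J J⊆ m lt)) = advance-left i∈ J⊆ lt m
        go (inj₁ (i , i∈ , focusing {st} {g} {u} refl j∈)) =
          -- No move of the game takes place: the same expression is represented one context deeper,
          -- at the same rank.
          explored (load-replace ((st ▹ g , u) ∷ []) i∈ (single i (st ▹ g , u) (focus-< st g u))) (suc k) (nf , step)
            (replace⊆L {J = _ ∷ []} I⊆ (λ { (here refl) → j∈ })) lists′ Γ⊆
          where
          lists′ : Lists X ((st ▹ g , u) ∷ I ∖ᵢ elem i)
          lists′ = to , from
            where
            to : X ⊆ map elem ((st ▹ g , u) ∷ I ∖ᵢ elem i)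
            to y∈ with ∈-map⁻ elem (X⊆ y∈)
            ... | j , j∈′ , refl with elem j ≟ elem i
            ...   | yes eq = here eq
            ...   | no neq = there (∈-map⁺ elem (∈-filter⁺ (λ i → ¬? (elem i ≟ _)) j∈′ neq))

            from : map elem ((st ▹ g , u) ∷ I ∖ᵢ elem i) ⊆ X
            from (here refl) = ⊆X (∈-map⁺ elem i∈)
            from (there y∈) with ∈-map⁻ elem y∈
            ... | j , j∈′ , refl = ⊆X (∈-map⁺ elem (proj₁ (∈-filter⁻ (λ i → ¬? (elem i ≟ _)) {xs = I} j∈′)))
        go (inj₂ idle) = finish (pol e) refl (right nonblocking) idle
          where
          nonblocking : ¬ Blocking X
          nonblocking (t , t∈ , neq , q) with ∈-map⁻ elem (X⊆ t∈)
          ... | i , i∈ , refl = idle⇒nonblocking (idle i∈) neq q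

        conclude : v ≤ e
        conclude = go (classify I I⊆)

      explore⇒≤ : ∀ {I Γ X e} → Acc _<ℕ_ (load I) → ∀ k → Rank winning k ⟨ Γ ∣ X ⊢ e ⟩ →
                 I ⊆ L → Lists X I → LettersIn Γ → v ≤ e
      explore⇒≤ {I} {Γ} {X} {e} (acc rs) (suc k) (nf , step) I⊆ lists Γ⊆ =
        Body.conclude k nf step I⊆ lists Γ⊆
          (λ lt → explore⇒≤ (rs lt)) (λ r → explore⇒≤ (acc rs) k r I⊆ lists Γ⊆)

    -- Exploring the items over a fixed context

    fresh : ∀ {v y} → Below v D → v ≤ y → y ∈ U → y ∉ D → v ≤ ω
    fresh {v} {y} below v≤y y∈U y∉D = ≤ω λ {p} (nf , w , within) →
      ih y∷D⊆U there (here refl) y∉D (λ { (here refl) → v≤y ; (there z∈) → below z∈ })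
        (nf , w , within-mono {p = p} there within)
      where
      y∷D⊆U : (y ∷ D) ⊆ U
      y∷D⊆U (here refl) = y∈U
      y∷D⊆U (there z∈) = D⊆U z∈

    total-++ : ∀ {i} J T A → load J <ℕ wt i → total (J ++ T) A <ℕ total (i ∷ T) A
    total-++ {i} J T A lt = subst (λ l → l + letterLoad A <ℕ total (i ∷ T) A) (sym (load-++ J T))
      (ℕₚ.+-monoˡ-< (letterLoad A) (ℕₚ.+-monoˡ-< (load T) lt))

    -- This fixes the size 3 of a letter: over a stack of weight `w` it exchanges `3 * w` for
    -- `1 + w`, and with size 2 nothing would be gained at `w = 1`.
    total-letter : ∀ st a T A → total T ((st , a) ∷ A) <ℕ total ((st , lit a) ∷ T) A
    total-letter st a T A = subst (_<ℕ total ((st , lit a) ∷ T) A)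
      (≡.trans (cong (_+ letterLoad A) (ℕₚ.+-comm (suc (wt (st , 𝟙))) (load T)))
        (ℕₚ.+-assoc (load T) (suc (wt (st , 𝟙))) (letterLoad A)))
      (ℕₚ.+-monoˡ-< (letterLoad A) (ℕₚ.+-monoˡ-< (load T)
        (ℕₚ.≤-<-trans (wt-mono-< st 1 2 (s≤s (s≤s z≤n))) (wt-mono-< st 2 3 (s≤s (s≤s (s≤s z≤n)))))))

    known-++ : ∀ {v v′ L i T A} J → Known v L (i ∷ T) A → v′ ≤ v → (∀ {j} → j ∈ J → v′ ≤ val j) →
               map elem J ⊆ D → Settled (J ++ L) i → Known v′ (J ++ L) (J ++ T) A
    known-++ {v} {v′} {L} {i} {T} {A} J K v′≤v J-values J⊆D σ = record
      { below = trans v′≤v ∘ below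
      ; values = λ j∈ → [ J-values , trans v′≤v ∘ values ]′ (∈-++⁻ J j∈)
      ; elems = λ j∈ → [ J⊆D ∘ ∈-map⁺ elem , elems ]′ (∈-++⁻ J j∈)
      ; roots = ∈-++⁺ʳ J ∘ roots
      ; todos = λ j∈ → [ ∈-++⁺ˡ , ∈-++⁺ʳ J ∘ todos ∘ there ]′ (∈-++⁻ J j∈)
      ; status = λ j∈ → [ todo ∘ ∈-++⁺ˡ , old ]′ (∈-++⁻ J j∈)
      }
      where
      open Known K
      old : ∀ {j} → j ∈ L → Status (J ++ L) (J ++ T) A j
      old j∈ with status j∈
      ... | settled τ = settled (settled-mono (∈-++⁺ʳ J) τ)
      ... | todo (here refl) = settled σ
      ... | todo (there j∈T) = todo (∈-++⁺ʳ J j∈T)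
      ... | letter a∈ = letter a∈

    known-letter : ∀ {v L st a T A} → Known v L ((st , lit a) ∷ T) A → Known v L T ((st , a) ∷ A)
    known-letter {L = L} {st} {a} {T} {A} K = record
      { below = below ; values = values ; elems = elems ; roots = roots ; todos = todos ∘ there
      ; status = old ∘ status
      }
      where
      open Known K
      old : ∀ {j} → Status L ((st , lit a) ∷ T) A j → Status L T ((st , a) ∷ A) j
      old (settled τ) = settled τ
      old (todo (here refl)) = letter (here refl)
      old (todo (there j∈)) = todo j∈
      old (letter a∈) = letter (there a∈)

    module Resolve {v L st u T A} (K : Known v L ((st , u) ∷ T) A)
                   (solved : ∀ {v′ L′ T′ A′} → total T′ A′ <ℕ total ((st , u) ∷ T) A →
                             Known v′ L′ T′ A′ → v′ ≤ ω) where

      open Known K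

      here-value : v ≤ head st ⋆ u
      here-value = values (todos (here refl))

      here∈U : plug (frames st) u ∈ U
      here∈U = D⊆U (elems (todos (here refl)))

      -- If an element of `J` lies outside `D`, the outer induction finishes at once through
      -- `fresh`; otherwise the items join `L`. The value `v′` may be smaller than `v`, as the
      -- branches for `⊔` and `◇` require.
      expand : ∀ {v′} J → v′ ≤ v → (∀ {j} → j ∈ J → v′ ≤ val j) → map elem J ⊆ U →
               Settled (J ++ L) (st , u) → load J <ℕ wt (st , u) → v′ ≤ ω
      expand {v′} J v′≤v J-values J⊆U σ lt with all? (λ j → elem j ∈? D) J
      ... | yes J∈D = solved (total-++ {st , u} J T A lt) (known-++ J K v′≤v J-values J⊆D σ)
        where
        J⊆D : map elem J ⊆ D
        J⊆D y∈ with ∈-map⁻ elem y∈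
        ... | j , j∈ , refl = All.lookup J∈D j∈
      ... | no ¬J∈D with find (¬All⇒Any¬ (λ j → elem j ∈? D) J ¬J∈D)
      ...   | j , j∈ , j∉D = fresh (trans v′≤v ∘ below) (trans (J-values j∈) (val≤elem (proj₁ j) (proj₂ j)))
                          (J⊆U (∈-map⁺ elem j∈)) j∉D

      ∃-expand : ∀ {v′} j {u′} → pol u ≡ ∃ₚ → u ⟶ u′ → plug (frames st) u′ ≡ elem j →
                 v′ ≤ v → v′ ≤ val j → wt j <ℕ wt (st , u) → v′ ≤ ω
      ∃-expand j p s eq v′≤v v′≤j lt = expand (j ∷ []) v′≤v (λ { (here refl) → v′≤j })
        (λ { (here refl) → U-closed here∈U step })
        (moved (j ∷ []) (λ { (here refl) → here refl }) (∃-move (≡.trans (pol-plug (frames st) u) p) step) lt′) lt′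
        where
        step : plug (frames st) u ⟶ elem j
        step = subst (plug (frames st) u ⟶_) eq (plug-step (frames st) s)

        lt′ : load (j ∷ []) <ℕ wt (st , u)
        lt′ = single (st , u) j lt

    resolve : ∀ {v L} st u {T A} (K : Known v L ((st , u) ∷ T) A) →
              (∀ {v′ L′ T′ A′} → total T′ A′ <ℕ total ((st , u) ∷ T) A → Known v′ L′ T′ A′ → v′ ≤ ω) → v ≤ ω
    resolve st (lit a) {T} {A} K solved = solved (total-letter st a T A) (known-letter K)
    resolve st 𝟘 K solved = trans (Resolve.here-value K solved) (trans ⋆-zero 0≤)
    resolve st ⊤ᵉ K solved = Resolve.expand K solved [] refl (λ ()) (λ ())
      (moved [] (λ ()) (∀-move (pol-plug (frames st) ⊤ᵉ) none (λ ())) (wt-mono-< st 0 1 (s≤s z≤n)))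
      (wt-mono-< st 0 1 (s≤s z≤n))
      where
      none : ∀ {y} → plug (frames st) ⊤ᵉ ⟶ y → y ∈ []
      none s with plug-step⁻ (frames st) (λ ()) s
      ... | _ , () , _
    resolve bot 𝟙 K solved = Resolve.expand K solved [] refl (λ ()) (λ ()) inert (s≤s z≤n)
    resolve (ret _ _ b≤ω _) 𝟙 K solved = trans (Resolve.here-value K solved) (trans unitʳ-≤ b≤ω)
    resolve (st ▹ g) 𝟙 K solved = expand ((st , g) ∷ []) refl
      (λ { (here refl) → trans here-value unitʳ-≤ }) (λ { (here refl) → U-closed here∈U step })
      (moved ((st , g) ∷ []) (λ { (here refl) → here refl }) (∃-move (pol-plug (frames st) (g ⋆ 𝟙)) step) lt) lt
      where
      open Resolve K solved

      step : plug (frames st) (g ⋆ 𝟙) ⟶ plug (frames st) g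
      step = plug-step (frames st) ⋆-𝟙

      lt : load ((st , g) ∷ []) <ℕ wt (st ▹ g , 𝟙)
      lt = single (st ▹ g , 𝟙) (st , g) (pop-< st g)
    resolve st (u₁ ⊔ u₂) K solved = ⊔-split (trans here-value ⋆-distr-⊔)
      (∃-expand (st , u₁) refl ⊔-l refl ⊓-l ⊓-r
        (wt-mono-< st (size u₁) (size (u₁ ⊔ u₂)) (s≤s (ℕₚ.m≤m+n (size u₁) (size u₂)))))
      (∃-expand (st , u₂) refl ⊔-r refl ⊓-l ⊓-r
        (wt-mono-< st (size u₂) (size (u₁ ⊔ u₂)) (s≤s (ℕₚ.m≤n+m (size u₂) (size u₁)))))
      where open Resolve K solved
    resolve st (u₁ ⊓ u₂) K solved = expand J refl
      (λ { (here refl) → trans here-value (⋆-mono refl ⊓-l)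
         ; (there (here refl)) → trans here-value (⋆-mono refl ⊓-r) })
      (λ y∈ → U-closed here∈U (sound y∈))
      (moved J (λ { (here refl) → here refl ; (there (here refl)) → there (here refl) })
        (∀-move (pol-plug (frames st) (u₁ ⊓ u₂)) complete sound) lt) lt
      where
      open Resolve K solved

      J : List Item
      J = (st , u₁) ∷ (st , u₂) ∷ []

      lt : load J <ℕ wt (st , u₁ ⊓ u₂)
      lt = pair-< st u₁ u₂ (size (u₁ ⊓ u₂)) (ℕₚ.n<1+n _)

      complete : ∀ {y} → plug (frames st) (u₁ ⊓ u₂) ⟶ y → y ∈ map elem J
      complete s with plug-step⁻ (frames st) (λ ()) s
      ... | _ , ⊓-l , refl = here refl
      ... | _ , ⊓-r , refl = there (here refl)

      sound : ∀ {y} → y ∈ map elem J → plug (frames st) (u₁ ⊓ u₂) ⟶ y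
      sound (here refl) = plug-step (frames st) ⊓-l
      sound (there (here refl)) = plug-step (frames st) ⊓-r
    resolve st (g ⋆ u) K solved = expand ((st ▹ g , u) ∷ []) refl
      (λ { (here refl) → trans here-value assoc-≤ }) (λ { (here refl) → here∈U })
      (refocus (here refl)) (single (st , g ⋆ u) (st ▹ g , u) (focus-< st g u))
      where open Resolve K solved
    resolve {v} st (c ◇) K solved =
      -- `⋆-⊓-left` brings `v` to the left of `c ◇`, where `exit` replaces `head st ⊓ v` by `b`.
      -- Keeping `v` as the side condition of `◇-ind` leaves all values of `L` available in every
      -- round.
      trans (⊓-glb refl (trans (⊓-glb here-value refl) (trans ⋆-⊓-left (⋆-mono exit refl)))) (trans (◇-ind loop) ⊓-r)
      where
      open Resolve K solved

      b : Expr n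
      b = (head st ⋆ c ◇) ⊓ ω

      b≤ : b ≤ plug (c ◇ ∷ frames st) 𝟙
      b≤ = trans ⊓-l (trans (val≤elem st (c ◇)) (plug-mono (frames st) unitʳ-≥))

      exit : head st ⊓ v ≤ b
      exit = ⊓-glb (trans ⊓-l (trans unitʳ-≥ (⋆-mono refl ◇-unit)))
        (∃-expand (st , 𝟙) refl ◇-𝟙 refl ⊓-r (trans ⊓-l unitʳ-≥)
          (wt-mono-< st 1 (size (c ◇)) (s≤s (s≤s z≤n))))

      loop : v ⊓ (b ⋆ c) ≤ b
      loop = ⊓-glb (trans ⊓-r (trans (⋆-mono ⊓-l refl) (trans assoc-≥ (⋆-mono refl ◇-unfold))))
        -- The body runs on a stack whose head is `b` itself, while the frames still spell out the
        -- element that the game sees.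
        (∃-expand (ret (c ◇ ∷ frames st) b ⊓-r b≤ , c) refl ◇-un refl ⊓-l ⊓-r (enter-< st c))

    solve : ∀ {v L} T A → Acc _<ℕ_ (total T A) → Known v L T A → v ≤ ω
    solve ((st , u) ∷ T) A (acc rs) K = resolve st u K (λ lt → solve _ _ (rs lt))
    solve {v} {L} [] A (acc rs) K = ≤ω λ {p} (nf , w , X⊆ , Γ⊆) →
      let (k , r) = W-rank nf w
      in Explore.explore⇒≤ K (λ lt → solve _ _ (rs lt)) (<-wellFounded _) k r (items⊆L X⊆) (lists (X p)) Γ⊆
      where
      items : List (Expr n) → List Item
      items = map (bot ,_)

      items⊆L : ∀ {X} → X ⊆ D → items X ⊆ L
      items⊆L X⊆ i∈ with ∈-map⁻ (bot ,_) i∈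
      ... | y , y∈ , refl = Known.roots K (X⊆ y∈)

      lists : ∀ X → Lists X (items X)
      lists X = (λ y∈ → ∈-map⁺ elem (∈-map⁺ (bot ,_) y∈)) , from
        where
        from : map elem (items X) ⊆ X
        from y∈ with ∈-map⁻ elem y∈
        ... | i , i∈ , refl with ∈-map⁻ (bot ,_) i∈
        ...   | y , y∈′ , refl = y∈′

    context-claim : Claim D
    context-claim {v} below good = trans (solve items [] (<-wellFounded _) record
      { below = below
      ; values = values
      ; elems = elems
      ; roots = ∈-map⁺ (bot ,_)
      ; todos = id
      ; status = todo
      }) (ω≤goal good)
      where
      items : List Item
      items = map (bot ,_) D

      values : ∀ {i} → i ∈ items → v ≤ val i
      values i∈ with ∈-map⁻ (bot ,_) i∈
      ... | y , y∈ , refl = trans (below y∈) unitˡ-≥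

      elems : ∀ {i} → i ∈ items → elem i ∈ D
      elems i∈ with ∈-map⁻ (bot ,_) i∈
      ... | y , y∈ , refl = y∈

  claim : ∀ D → D ⊆ U → Claim D
  claim D = go D (<-wellFounded _)
    where
    missing? : ∀ D s → Dec (s ∉ D)
    missing? D s = ¬? (s ∈? D)

    go : ∀ D → Acc _<ℕ_ (length (filter (missing? D) U)) → D ⊆ U → Claim D
    go D (acc rs) D⊆U = Context.context-claim D D⊆U λ {D′} D′⊆U D⊆D′ s∈ s∉ →
      go D′ (rs (length-filter-strict (missing? D′) (missing? D) (λ _ z∉ z∈ → z∉ (D⊆D′ z∈)) (D′⊆U s∈)
        (λ s∉′ → s∉′ s∈) s∉)) D′⊆U

theorem4p1 : ∀ {n : ℕ} (e f : Expr n) → DuplicatorWins ⟨ ∅ ∣ e ∷ [] ⊢ f ⟩ → e ≤ f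
theorem4p1 {n} e f ws =
  claim (e ∷ []) [e]⊆U (λ { (here refl) → refl })
    ((norm-idem (e ∷ []) [e]⊆U , self∈closure f) , start∈W , norm⊆ , λ a a∈ → contradiction a∈ ∉⊥)
  where
  letters : List (Expr n)
  letters = map (λ a → ⊤ᵉ ⋆ lit a) (allFin n)

  -- The expressions `⊤ᵉ ⋆ lit a` are included so that a context inside `U` can also record the
  -- letters of `Γ`.
  U : List (Expr n)
  U = concatMap closure (e ∷ letters)

  ∈U : ∀ {x} → x ∈ e ∷ letters → x ∈ U
  ∈U x∈ = ∈-concatMap⁺ closure (lose x∈ (self∈closure _))

  [e]⊆U : (e ∷ []) ⊆ U
  [e]⊆U (here refl) = ∈U (here refl)

  U-closed : Closed U
  U-closed = concatMap-closure-closed (e ∷ letters)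

  open Arena U (closure f)
  open Strategy U (closure f) U-closed (closure-closed f) ws [e]⊆U (self∈closure f)
  open Derivation U (closure f) U-closed (closure-closed f)
    (λ a → ∈U (there (∈-map⁺ _ (∈-allFin a))))
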